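{- Let $G=(V,E,w)$ be a finite connected graph with $|V|=n\ge2$ and weights $w:E\to\mathbb{R}_{>0}$. Let $T\in\mathcal T_{\mathrm{conn}}^{\mathrm{bin}}(G)$ satisfy $$F(T)\le\alpha\operatorname{OPT}_{\mathrm{free}}(G,w)$$ for some $\alpha\ge1$. Suppose that a function $\Phi:[1,n-1]\to\mathbb R_{\ge0}$ satisfies $$\mu_T\bigl(\{S:\rho_T(S)>t\}\bigr)\le\Phi(t)\qquad\text{for every }t\in[1,n-1].$$ Then $$\operatorname{OPT}_{\mathrm{card}}(G,w)\le\alpha\left(1+\int_1^{n-1}\Phi(t)\,dt\right)\operatorname{OPT}_{\mathrm{free}}(G,w).$$
   Context: $d_G$ is the shortest-path metric of $(V,E)$ with every edge of length $1$ (weights are not lengths); $\operatorname{diam}_{d_G}(S)=\max_{a,b\in S}d_G(a,b)$. A rooted binary hierarchy $T$ on $V$ is a rooted tree whose leaves are the vertices of $V$ and whose internal nodes have exactly two children; each node is identified with the set of leaves below it (a cluster); $C_T(x,y)$ is the cluster of the lowest common ancestor of $x,y$. $\mathcal T_{\mathrm{conn}}^{\mathrm{bin}}(G)$ is the set of rooted binary hierarchies on $V$ all of whose clusters induce connected subgraphs of $G$. $\mathcal I(T)$ is the family of internal (non-leaf) clusters. For $S\in\mathcal I(T)$ with children $S^0,S^1$: $b_T(S)$ is the total weight of edges with one endpoint in $S^0$ and the other in $S^1$; $\Delta_T(S)=\operatorname{diam}_{d_G}(S)$; $a_T(S)=\Delta_T(S)b_T(S)$; $\rho_T(S)=(|S|-1)/\Delta_T(S)$.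 $F(T)=\sum_{xy\in E}w_{xy}\operatorname{diam}_{d_G}(C_T(x,y))>0$, and $\mu_T(S)=a_T(S)/F(T)$ for $S\in\mathcal I(T)$, which defines a probability measure on $\mathcal I(T)$; the set $\{S:\rho_T(S)>t\}$ consists of clusters $S\in\mathcal I(T)$. $\operatorname{OPT}_{\mathrm{free}}(G,w)$ is the minimum of $\sum_{xy\in E}w_{xy}u(x,y)$ over all ultrametrics $u$ on $V$ (metrics with $u(x,y)\le\max\{u(x,z),u(z,y)\}$ for all $x,y,z$) with $u\ge d_G$ on all pairs. For a rooted binary hierarchy $H$ on $V$ put $h_H(x,x)=0$ and $h_H(x,y)=|C_H(x,y)|-1$ for $x\ne y$; $\operatorname{OPT}_{\mathrm{card}}(G,w)$ is the minimum of $\sum_{xy\in E}w_{xy}h_H(x,y)$ over all rooted binary hierarchies $H$ on $V$ with $h_H\ge d_G$ on all pairs. -}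

module Defs where

open import Algebra.Bundles using (CommutativeRing)
import Algebra.Construct.NaturalChoice.Max as Max
import Algebra.Definitions.RawMonoid as RawMonoid
open import Data.Bool.Base using (if_then_else_)
open import Data.Fin.Base as Fin using (Fin)
import Data.Fin.Properties as Fin
open import Data.List.Base
  using (List; []; _∷_; [_]; _++_; map; foldr; filter; length; allFin;
         cartesianProduct; cartesianProductWith)
import Data.List.Extrema.Nat as Extrema
open import Data.List.Membership.Propositional using (_∈_)
open import Data.List.Relation.Binary.Permutation.Propositional using (_↭_)
open import Data.List.Relation.Unary.All using (All)
open import Data.List.Relation.Unary.AllPairs using (AllPairs)
open import Data.Nat.Base as ℕ using (ℕ; zero; suc; _∸_)
open import Data.Product.Base using (Σ; ∃; ∃-syntax; _×_; _,_; proj₁; uncurry)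
import Function.Metric.Structures as Metric
open import Level using (0ℓ; Level) renaming (suc to lsuc)
open import Relation.Binary.Bundles using (DecTotalOrder)
import Relation.Binary.Construct.NonStrictToStrict as Strict
open import Relation.Binary.Core using (Rel)
open import Relation.Binary.Definitions
  using (Symmetric; Irreflexive; _Respects_) renaming (Decidable to Decidable₂)
open import Relation.Binary.PropositionalEquality.Core using (_≡_; refl)
open import Relation.Binary.Structures using (IsDecTotalOrder)
open import Relation.Nullary.Decidable using (does; map′; _×-dec_)
open import Relation.Nullary.Negation using (¬_)
open import Relation.Unary using (Pred; Decidable; Satisfiable; _⊆_; _∖_; Empty; _∩_)

import Data.List.Membership.DecPropositional as DecMembership

private
  variable
    p : Level

module Bounds {A : Set} (_≤_ : Rel A 0ℓ) where

  UpperBound LowerBound : Pred A p → Pred A p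
  UpperBound P b = ∀ {x} → P x → x ≤ b
  LowerBound P b = ∀ {x} → P x → b ≤ x

  IsSupremum IsInfimum IsMinimum : Pred A p → Pred A p
  IsSupremum P s = UpperBound P s × (∀ {b} → UpperBound P b → s ≤ b)
  IsInfimum  P i = LowerBound P i × (∀ {b} → LowerBound P b → b ≤ i)
  IsMinimum  P m = P m × LowerBound P m

-- The library has no real numbers, so ℝ enters through its axioms: it is
-- the complete ordered field, unique up to isomorphism.  The order is
-- decidable, as it is classically.
record CompleteOrderedField : Set₁ where
  infix  4 _≤_
  infixl 8 _⁻¹
  field
    commutativeRing : CommutativeRing 0ℓ 0ℓ

  open CommutativeRing commutativeRing public
    hiding (refl; sym; trans; reflexive; zero)

  field
    _≤_             : Rel Carrier 0ℓ
    isDecTotalOrder : IsDecTotalOrder _≈_ _≤_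
    +-monoˡ-≤       : ∀ z {x y} → x ≤ y → x + z ≤ y + z
    *-nonNegative   : ∀ {x y} → 0# ≤ x → 0# ≤ y → 0# ≤ x * y
    0≉1             : ¬ 0# ≈ 1#
    -- The value at 0# is unspecified.
    _⁻¹             : Carrier → Carrier
    ⁻¹-inverseʳ     : ∀ {x} → ¬ x ≈ 0# → x * x ⁻¹ ≈ 1#

  open Bounds _≤_ public

  field
    supremum : (P : Pred Carrier 0ℓ) → Satisfiable P →
               Satisfiable (UpperBound P) → Satisfiable (IsSupremum P)

  decTotalOrder : DecTotalOrder 0ℓ 0ℓ 0ℓ
  decTotalOrder = record { isDecTotalOrder = isDecTotalOrder }

  open DecTotalOrder decTotalOrder public using (_≟_; _≤?_; totalOrder)
  open Strict _≈_ _≤_ public using (_<_)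
  open Max totalOrder public using (_⊔_)

  _<?_ : Decidable₂ _<_
  _<?_ = Strict.<-decidable _≈_ _≤_ _≟_ _≤?_

  infix 4 _∈[_,_]
  _∈[_,_] : Carrier → Carrier → Carrier → Set
  x ∈[ a , b ] = a ≤ x × x ≤ b

  fromℕ : ℕ → Carrier
  fromℕ k = RawMonoid._×_ +-rawMonoid k 1#

  ∑ : ∀ {a} {A : Set a} → List A → (A → Carrier) → Carrier
  ∑ xs f = foldr _+_ 0# (map f xs)

module Lebesgue (ℝ : CompleteOrderedField) where

  open CompleteOrderedField ℝ

  partialSum : (ℕ → Carrier) → ℕ → Carrier
  partialSum f zero    = 0#
  partialSum f (suc k) = partialSum f k + f k

  -- Only used for series with nonnegative terms.
  IsSeriesSum : (ℕ → Carrier) → Pred Carrier 0ℓ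
  IsSeriesSum f = IsSupremum (λ s → ∃[ k ] s ≈ partialSum f k)

  record Cover (A : Pred Carrier 0ℓ) (total : Carrier) : Set where
    field
      left right  : ℕ → Carrier
      left≤right  : ∀ k → left k ≤ right k
      covers      : ∀ {x} → A x → ∃[ k ] x ∈[ left k , right k ]
      total-isSum : IsSeriesSum (λ k → right k - left k) total

  -- A set of infinite outer measure is in relation with no number.
  IsOuterMeasure : Pred Carrier 0ℓ → Pred Carrier 0ℓ
  IsOuterMeasure A = IsInfimum (Cover A)

  IsOpen : Pred Carrier 0ℓ → Set
  IsOpen O = ∀ {x} → O x →
    ∃[ ε ] (0# < ε × (∀ {y} → x - ε < y → y < x + ε → O y))

  -- Lebesgue measurability in the form: up to every ε, A is open in outer
  -- measure.
  record IsMeasurable (A : Pred Carrier 0ℓ) : Set₁ where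
    field
      respects : A Respects _≈_
      openApproximation : ∀ {ε} → 0# < ε →
        Σ (Pred Carrier 0ℓ) λ O → IsOpen O × A ⊆ O ×
          ∃[ m ] (IsOuterMeasure (O ∖ A) m × m ≤ ε)

  -- One term c · 1_A of a simple function with 0 ≤ c · 1_A ≤ f on [a , b].
  record Piece (f : Carrier → Carrier) (a b : Carrier) : Set₁ where
    field
      set        : Pred Carrier 0ℓ
      height     : Carrier
      measure    : Carrier
      measurable : IsMeasurable set
      isMeasure  : IsOuterMeasure set measure
      inInterval : ∀ {x} → set x → x ∈[ a , b ]
      height≥0   : 0# ≤ height
      below      : ∀ {x} → set x → height ≤ f x

  open Piece public using (set; height; measure)

  -- The integrals of the nonnegative simple functions below f on [a , b].
  -- The pieces are disjoint, so comparing them one by one with f compares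
  -- their sum with f, as f is nonnegative.
  SimpleIntegral : (Carrier → Carrier) → (a b : Carrier) → Pred Carrier (lsuc 0ℓ)
  SimpleIntegral f a b v =
    Σ (List (Piece f a b)) λ ps →
      AllPairs (λ P Q → Empty (set P ∩ set Q)) ps ×
      v ≈ ∑ ps (λ P → height P * measure P)

  -- f is a function on [a , b] with values in the nonnegative reals; its
  -- values outside [a , b] play no role.
  record IsNonNegativeOn (f : Carrier → Carrier) (a b : Carrier) : Set where
    field
      cong        : ∀ {s t} → s ∈[ a , b ] → t ∈[ a , b ] → s ≈ t → f s ≈ f t
      nonNegative : ∀ {t} → t ∈[ a , b ] → 0# ≤ f t

  -- I is the (finite) Lebesgue integral over [a , b] of the nonnegative f.
  record IsIntegral (f : Carrier → Carrier) (a b I : Carrier) : Set₁ where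
    field
      measurable : ∀ c → IsMeasurable (λ t → t ∈[ a , b ] × f t < c)
      isSupremum : IsSupremum (SimpleIntegral f a b) I

data Walk {V : Set} (R : Rel V 0ℓ) : ℕ → Rel V 0ℓ where
  []  : ∀ {x} → Walk R zero x x
  _∷_ : ∀ {k x y z} → R x y → Walk R k y z → Walk R (suc k) x z

walk? : ∀ {n} {R : Rel (Fin n) 0ℓ} → Decidable₂ R → ∀ k → Decidable₂ (Walk R k)
walk? R? zero    x y = map′ (λ { refl → [] }) (λ { [] → refl }) (x Fin.≟ y)
walk? R? (suc k) x y =
  map′ (λ { (_ , r , p) → r ∷ p }) (λ { (r ∷ p) → _ , r , p })
       (Fin.any? λ z → R? x z ×-dec walk? R? k z y)

-- The least k < bound satisfying P, or bound if there is none; so the least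
-- witness outright when bound is itself a witness.
least : {P : Pred ℕ 0ℓ} → Decidable P → (bound : ℕ) → ℕ
least P? zero        = zero
least P? (suc bound) =
  if does (P? zero) then zero else suc (least (λ k → P? (suc k)) bound)

data Tree (V : Set) : Set where
  leaf : V → Tree V
  node : Tree V → Tree V → Tree V

leaves : ∀ {V} → Tree V → List V
leaves (leaf x)   = [ x ]
leaves (node l r) = leaves l ++ leaves r

subtrees : ∀ {V} → Tree V → List (Tree V)
subtrees (leaf x)   = [ leaf x ]
subtrees (node l r) = node l r ∷ subtrees l ++ subtrees r

-- An internal node is given by the pair of its children.
Internal : Set → Set
Internal V = Tree V × Tree V

internals : ∀ {V} → Tree V → List (Internal V)
internals (leaf x)   = []
internals (node l r) = (l , r) ∷ internals l ++ internals r

cluster : ∀ {V} → Internal V → List V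
cluster (l , r) = leaves (node l r)

IsHierarchy : ∀ {n} → Tree (Fin n) → Set
IsHierarchy {n} T = leaves T ↭ allFin n

module _ {n : ℕ} where

  open DecMembership (Fin._≟_ {n}) using (_∈?_)

  lca : Tree (Fin n) → Fin n → Fin n → Tree (Fin n)
  lca (leaf v)   x y = leaf v
  lca (node l r) x y =
    if does (x ∈? leaves l ×-dec y ∈? leaves l) then lca l x y else
    if does (x ∈? leaves r ×-dec y ∈? leaves r) then lca r x y else
    node l r

  lcaCluster : Tree (Fin n) → Fin n → Fin n → List (Fin n)
  lcaCluster T x y = leaves (lca T x y)

  cardHeight : Tree (Fin n) → Fin n → Fin n → ℕ
  cardHeight H x y =
    if does (x Fin.≟ y) then 0 else length (lcaCluster H x y) ∸ 1

module Graphs (ℝ : CompleteOrderedField) where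

  open CompleteOrderedField ℝ

  -- The weight of a pair that is not an edge plays no role.
  record ConnectedWeightedGraph (n : ℕ) : Set₁ where
    field
      Adj         : Rel (Fin n) 0ℓ
      Adj?        : Decidable₂ Adj
      Adj-sym     : Symmetric Adj
      Adj-irrefl  : Irreflexive _≡_ Adj
      connected   : ∀ x y → ∃[ k ] Walk Adj k x y
      weight      : Fin n → Fin n → Carrier
      weight-sym  : ∀ {x y} → Adj x y → weight x y ≈ weight y x
      weight-pos  : ∀ {x y} → Adj x y → 0# < weight x y

  module _ {n : ℕ} (G : ConnectedWeightedGraph n) where

    open ConnectedWeightedGraph G

    private
      V : Set
      V = Fin n

    dist : V → V → ℕ
    dist x y = least (λ k → walk? Adj? k x y) (proj₁ (connected x y))

    diam : List V → ℕ
    diam S = Extrema.max 0 (cartesianProductWith dist S S)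

    InducesConnected : List V → Set
    InducesConnected S = ∀ {x y} → x ∈ S → y ∈ S →
      ∃[ k ] Walk (λ u v → u ∈ S × v ∈ S × Adj u v) k x y

    IsConnectedHierarchy : Tree V → Set
    IsConnectedHierarchy T =
      IsHierarchy T × All (λ S → InducesConnected (leaves S)) (subtrees T)

    -- Each edge is listed once, with its smaller endpoint first.
    edges : List (V × V)
    edges = filter (λ (x , y) → (x Fin.<? y) ×-dec Adj? x y)
                   (cartesianProduct (allFin n) (allFin n))

    cost : (V → V → Carrier) → Carrier
    cost u = ∑ edges λ (x , y) → weight x y * u x y

    F : Tree V → Carrier
    F T = cost λ x y → fromℕ (diam (lcaCluster T x y))

    cutWeight : Internal V → Carrier
    cutWeight (l , r) =
      ∑ (filter (λ (x , y) → Adj? x y) (cartesianProduct (leaves l) (leaves r)))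
        (uncurry weight)

    Δ : Internal V → ℕ
    Δ S = diam (cluster S)

    a : Internal V → Carrier
    a S = fromℕ (Δ S) * cutWeight S

    ρ : Internal V → Carrier
    ρ S = fromℕ (length (cluster S) ∸ 1) * fromℕ (Δ S) ⁻¹

    μ : Tree V → {P : Pred (Internal V) 0ℓ} → Decidable P → Carrier
    μ T P? = ∑ (filter P? (internals T)) λ S → a S * F T ⁻¹

    -- The strong triangle inequality and nonnegativity give the ordinary
    -- triangle inequality.
    IsUltrametric : (V → V → Carrier) → Set
    IsUltrametric = Metric.IsGeneralMetric _≡_ _≈_ _≤_ 0# _⊔_

    FreeValue : Pred Carrier 0ℓ
    FreeValue v = ∃[ u ] (IsUltrametric u ×
      (∀ x y → fromℕ (dist x y) ≤ u x y) × v ≈ cost u)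

    CardValue : Pred Carrier 0ℓ
    CardValue v = ∃[ H ] (IsHierarchy H ×
      (∀ x y → dist x y ℕ.≤ cardHeight H x y) ×
      v ≈ cost (λ x y → fromℕ (cardHeight H x y)))

    IsOPTfree IsOPTcard : Pred Carrier 0ℓ
    IsOPTfree = IsMinimum FreeValue
    IsOPTcard = IsMinimum CardValue

{-# OPTIONS --safe #-}

-- Take H = T.  A connected cluster with k leaves has diameter at most k - 1,
-- so h_T ≥ d_G and every ρ(S) ≥ 1.  Summing an edge cost over the cluster
-- where the edge is cut gives
--   cost h_T = Σ_S (|S| - 1) b(S) = F(T) · Σ_S μ(S) ρ(S)
--            = F(T) · (1 + Σ_S μ(S) (ρ(S) - 1)),
-- and by the layer cake formula the last sum is ∫ μ(ρ > t) dt over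
-- [1 , n - 1].  The integrand is a step function with jumps at the values of
-- ρ, so its integral is the value of one simple function below Φ, which is
-- built from open intervals.  That these have their length as outer measure is
-- where completeness enters.

module Submission where

open import Defs
open import Data.Fin using (Fin)
open import Data.Nat as ℕ using (ℕ; zero; suc; _∸_; z≤n; s≤s)

open import Algebra.Bundles using (CommutativeRing)
import Algebra.Construct.NaturalChoice.Max as Max
import Algebra.Construct.NaturalChoice.Min as Min
import Algebra.Properties.AbelianGroup as AbelianGroupProperties
import Algebra.Properties.Ring as RingProperties
import Algebra.Properties.Semiring.Mult.TCOptimised as OptimisedMult
import Algebra.Solver.Ring as RingSolver
open import Algebra.Solver.Ring.AlmostCommutativeRing
  using (fromCommutativeRing; _-Raw-AlmostCommutative⟶_)
open import Data.Bool.Base using (true; false; if_then_else_)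
import Data.Fin.Properties as Fin
open import Data.Integer.Base as ℤ using (ℤ; +_; -[1+_])
import Data.Integer.Properties as ℤ
open import Data.List.Base
  using (List; []; _∷_; _++_; map; filter; length; allFin; cartesianProduct)
import Data.List.Extrema.Nat as Extrema
import Data.List.Membership.DecPropositional as DecMembership
open import Data.List.Membership.Propositional using (_∈_)
open import Data.List.Membership.Propositional.Properties
  using (∈-allFin; ∈-++⁺ˡ; ∈-++⁺ʳ; ∈-++⁻; ∈-filter⁺; ∈-filter⁻;
         ∈-cartesianProduct⁺; ∈-cartesianProductWith⁺)
import Data.List.Properties as List
open import Data.List.Relation.Binary.Disjoint.Propositional using (Disjoint)
open import Data.List.Relation.Binary.Permutation.Propositional
  using (_↭_; refl; prep; swap; trans; ↭-sym; ↭⇒↭ₛ)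
import Data.List.Relation.Binary.Permutation.Propositional.Properties as ↭
import Data.List.Relation.Binary.Permutation.Setoid.Properties as ↭ₛ
open import Data.List.Relation.Unary.All as All using (All; []; _∷_)
import Data.List.Relation.Unary.All.Properties as All
open import Data.List.Relation.Unary.AllPairs using (AllPairs; []; _∷_)
open import Data.List.Relation.Unary.Any using (here; there)
open import Data.List.Relation.Unary.Sorted.TotalOrder.Properties using (Sorted⇒AllPairs)
open import Data.List.Relation.Unary.Unique.Propositional using (Unique)
import Data.List.Relation.Unary.Unique.Propositional.Properties as Unique
import Data.List.Sort as Sort
import Data.Maybe.Base as Maybe
import Data.Nat.Properties as ℕ
open import Data.Product.Base
  using (_×_; _,_; proj₁; proj₂; ∃-syntax; Σ-syntax; uncurry)
import Data.Sign.Base as Sign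
open import Data.Sum.Base using (inj₁; inj₂)
open import Level using (0ℓ; Level)
open import Relation.Binary.Bundles using (DecTotalOrder)
import Relation.Binary.Construct.On as On
open import Relation.Binary.Core using (Rel)
open import Relation.Binary.Definitions using (tri<; tri≈; tri>)
open import Relation.Binary.PropositionalEquality.Core as ≡ using (_≡_; _≢_)
open import Relation.Binary.PropositionalEquality.Properties
  using () renaming (setoid to ≡-setoid)
import Relation.Binary.Reasoning.PartialOrder as PartialOrderReasoning
import Relation.Binary.Reasoning.Setoid as SetoidReasoning
open import Relation.Nullary using (¬_; yes; no; Dec; does)
open import Relation.Nullary.Decidable
  using (_×-dec_; dec-true; dec-false; dec⇒maybe; decidable-stable)
open import Relation.Nullary.Negation using (contradiction)
open import Relation.Unary using (Pred; Decidable; Empty; _∩_)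

-- Ordered fields

-- Each piece of a simple function carries a measurable set together with its outer measure, so the
-- step function has to be realised and not only computed. Open intervals keep this light: an open
-- set is its own outer approximation, with empty remainder, and neighbouring layers that share an
-- endpoint become disjoint once that endpoint is dropped. The hard half is that no countable cover
-- of an interval has total length below the length of the interval. Cover intervals are closed, so
-- a supremum of reached points could sit at the end of one of them and go no further. Widening
-- every interval by a summable amount puts the supremum strictly inside one of them, from where
-- more can be reached.

module OrderedField (ℝ : CompleteOrderedField) where

  open CompleteOrderedField ℝ public
  open DecTotalOrder decTotalOrder public using (poset; ≤-respˡ-≈; ≤-respʳ-≈)
    renaming (refl to ≤-refl; trans to ≤-trans; reflexive to ≤-reflexive;
              antisym to ≤-antisym; total to ≤-total)
  open CommutativeRing commutativeRing public using ()
    renaming (refl to ≈-refl; sym to ≈-sym; trans to ≈-trans; reflexive to ≈-reflexive)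
  open Min totalOrder public using (_⊓_; x⊓y≤y; ⊓-monoˡ-≤; x≤y⇒x⊓y≈x)
  open Max totalOrder public using (x≤x⊔y; ⊔-lub; ⊔-monoʳ-≤; x≤y⇒x⊔y≈y)

  -- Integer coefficients let the solver cancel terms, which coefficients in
  -- an abstract ring would not.
  module Solver where
    private
      -- For this multiple `1 · 1#` computes to `1#`, so `con (+ 1)` denotes the literal `1#` and
      -- solver equations match goals by `≈-refl`.
      open OptimisedMult semiring using (×1-homo-*; ×-homo-+; 1+×) renaming (_×_ to _·_)
      open RingProperties ring using (-‿distribˡ-*; -‿distribʳ-*)
      open AbelianGroupProperties +-abelianGroup
        using () renaming (⁻¹-involutive to -‿involutive; ε⁻¹≈ε to -0≈0; ⁻¹-∙-comm to -‿+-comm)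
      open SetoidReasoning setoid

      ⟦_⟧ℤ : ℤ → Carrier
      ⟦ + n      ⟧ℤ = n · 1#
      ⟦ -[1+ n ] ⟧ℤ = - (suc n · 1#)

      cancel-1 : ∀ x y → x - y ≈ (1# + x) - (1# + y)
      cancel-1 x y = begin
        x - y                       ≈⟨ +-congʳ (+-identityˡ x) ⟨
        (0# + x) - y                ≈⟨ +-congʳ (+-congʳ (-‿inverseˡ 1#)) ⟨
        ((- 1# + 1#) + x) - y       ≈⟨ +-congʳ (+-assoc _ _ _) ⟩
        (- 1# + (1# + x)) - y       ≈⟨ +-congʳ (+-comm _ _) ⟩
        ((1# + x) - 1#) - y         ≈⟨ +-assoc _ _ _ ⟩
        (1# + x) + (- 1# - y)       ≈⟨ +-congˡ (-‿+-comm _ _) ⟩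
        (1# + x) - (1# + y)         ∎

      ⊖-homo : ∀ m n → ⟦ m ℤ.⊖ n ⟧ℤ ≈ m · 1# - n · 1#
      ⊖-homo zero    zero    = ≈-sym (-‿inverseʳ 0#)
      ⊖-homo zero    (suc n) = ≈-sym (+-identityˡ _)
      ⊖-homo (suc m) zero    = ≈-sym (≈-trans (+-congˡ -0≈0) (+-identityʳ _))
      ⊖-homo (suc m) (suc n) = begin
        ⟦ suc m ℤ.⊖ suc n ⟧ℤ            ≡⟨ ≡.cong ⟦_⟧ℤ (ℤ.[1+m]⊖[1+n]≡m⊖n m n) ⟩
        ⟦ m ℤ.⊖ n ⟧ℤ                    ≈⟨ ⊖-homo m n ⟩
        m · 1# - n · 1#                 ≈⟨ cancel-1 _ _ ⟩
        (1# + m · 1#) - (1# + n · 1#)   ≈⟨ +-cong (1+× m 1#) (-‿cong (1+× n 1#)) ⟨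
        suc m · 1# - suc n · 1#         ∎

      +-homo : ∀ i j → ⟦ i ℤ.+ j ⟧ℤ ≈ ⟦ i ⟧ℤ + ⟦ j ⟧ℤ
      +-homo (+ m)    (+ n)    = ×-homo-+ 1# m n
      +-homo (+ m)    -[1+ n ] = ⊖-homo m (suc n)
      +-homo -[1+ m ] (+ n)    = ≈-trans (⊖-homo n (suc m)) (+-comm _ _)
      +-homo -[1+ m ] -[1+ n ] = begin
        - (suc (suc (m ℕ.+ n)) · 1#)        ≡⟨ ≡.cong (λ k → - (k · 1#)) (ℕ.+-suc (suc m) n) ⟨
        - ((suc m ℕ.+ suc n) · 1#)          ≈⟨ -‿cong (×-homo-+ 1# (suc m) (suc n)) ⟩
        - (suc m · 1# + suc n · 1#)         ≈⟨ -‿+-comm _ _ ⟨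
        - (suc m · 1#) - (suc n · 1#)       ∎

      -◃-homo : ∀ n → ⟦ Sign.- ℤ.◃ n ⟧ℤ ≈ - (n · 1#)
      -◃-homo zero    = ≈-sym -0≈0
      -◃-homo (suc n) = ≈-refl

      +◃-homo : ∀ n → ⟦ Sign.+ ℤ.◃ n ⟧ℤ ≈ n · 1#
      +◃-homo zero    = ≈-refl
      +◃-homo (suc n) = ≈-refl

      *-homo : ∀ i j → ⟦ i ℤ.* j ⟧ℤ ≈ ⟦ i ⟧ℤ * ⟦ j ⟧ℤ
      *-homo (+ m) (+ n) = ≈-trans (+◃-homo (m ℕ.* n)) (×1-homo-* m n)
      *-homo (+ m) -[1+ n ] = begin
        ⟦ Sign.- ℤ.◃ (m ℕ.* suc n) ⟧ℤ ≈⟨ -◃-homo (m ℕ.* suc n) ⟩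
        - ((m ℕ.* suc n) · 1#)        ≈⟨ -‿cong (×1-homo-* m (suc n)) ⟩
        - (m · 1# * suc n · 1#)       ≈⟨ -‿distribʳ-* _ _ ⟩
        m · 1# * - (suc n · 1#)       ∎
      *-homo -[1+ m ] (+ n) = begin
        ⟦ Sign.- ℤ.◃ (suc m ℕ.* n) ⟧ℤ ≈⟨ -◃-homo (suc m ℕ.* n) ⟩
        - ((suc m ℕ.* n) · 1#)        ≈⟨ -‿cong (×1-homo-* (suc m) n) ⟩
        - (suc m · 1# * n · 1#)       ≈⟨ -‿distribˡ-* _ _ ⟩
        - (suc m · 1#) * n · 1#       ∎
      *-homo -[1+ m ] -[1+ n ] = begin
        (suc m ℕ.* suc n) · 1#               ≈⟨ ×1-homo-* (suc m) (suc n) ⟩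
        suc m · 1# * suc n · 1#              ≈⟨ -‿involutive _ ⟨
        - - (suc m · 1# * suc n · 1#)        ≈⟨ -‿cong (-‿distribʳ-* _ _) ⟩
        - (suc m · 1# * - (suc n · 1#))      ≈⟨ -‿distribˡ-* _ _ ⟩
        - (suc m · 1#) * - (suc n · 1#)      ∎

      -‿homo : ∀ i → ⟦ ℤ.- i ⟧ℤ ≈ - ⟦ i ⟧ℤ
      -‿homo (+ zero)  = ≈-sym -0≈0
      -‿homo (+ suc n) = ≈-refl
      -‿homo -[1+ n ]  = ≈-sym (-‿involutive _)

      morphism : ℤ.+-*-rawRing -Raw-AlmostCommutative⟶ fromCommutativeRing commutativeRing
      morphism = record
        { ⟦_⟧ = ⟦_⟧ℤ ; +-homo = +-homo ; *-homo = *-homo ; -‿homo = -‿homo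
        ; 0-homo = ≈-refl ; 1-homo = ≈-refl }

    open RingSolver ℤ.+-*-rawRing (fromCommutativeRing commutativeRing) morphism
      (λ i j → Maybe.map (λ i≡j → ≈-reflexive (≡.cong ⟦_⟧ℤ i≡j)) (dec⇒maybe (i ℤ.≟ j))) public
      using (solve; con; _:+_; _:*_; _:-_; _:=_)

  open Solver public

  private
    module ≤-Reasoning = PartialOrderReasoning poset

  -- The equation says `y - x ≈ q - p`, written without subtraction. It turns every linear
  -- rearrangement of an inequality into one ring identity for the solver.
  ≤-transport : ∀ {p q x y} → p ≤ q → y + p ≈ x + q → x ≤ y
  ≤-transport {p} {q} {x} {y} p≤q eq = begin
    x             ≈⟨ solve 2 (λ x q → x := (x :+ q) :- q) ≈-refl x q ⟩
    (x + q) - q   ≈⟨ +-congʳ eq ⟨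
    (y + p) - q   ≈⟨ solve 3 (λ y p q → (y :+ p) :- q := p :+ (y :- q)) ≈-refl y p q ⟩
    p + (y - q)   ≤⟨ +-monoˡ-≤ (y - q) p≤q ⟩
    q + (y - q)   ≈⟨ solve 2 (λ y q → q :+ (y :- q) := y) ≈-refl y q ⟩
    y             ∎
    where open ≤-Reasoning

  +-mono-≤ : ∀ {x y u v} → x ≤ y → u ≤ v → x + u ≤ y + v
  +-mono-≤ {x} {y} {u} {v} x≤y u≤v = begin
    x + u  ≤⟨ +-monoˡ-≤ u x≤y ⟩
    y + u  ≈⟨ +-comm y u ⟩
    u + y  ≤⟨ +-monoˡ-≤ y u≤v ⟩
    v + y  ≈⟨ +-comm v y ⟩
    y + v  ∎
    where open ≤-Reasoning

  x≤y⇒0≤y-x : ∀ {x y} → x ≤ y → 0# ≤ y - x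
  x≤y⇒0≤y-x {x} {y} x≤y =
    ≤-transport x≤y (solve 2 (λ x y → (y :- x) :+ x := con (+ 0) :+ y) ≈-refl x y)

  *-monoˡ-≤ : ∀ {z x y} → 0# ≤ z → x ≤ y → z * x ≤ z * y
  *-monoˡ-≤ {z} {x} {y} 0≤z x≤y =
    ≤-transport (*-nonNegative 0≤z (x≤y⇒0≤y-x x≤y))
      (solve 3 (λ x y z → z :* y :+ con (+ 0) := z :* x :+ z :* (y :- x)) ≈-refl x y z)

  *-monoʳ-≤ : ∀ {z x y} → 0# ≤ z → x ≤ y → x * z ≤ y * z
  *-monoʳ-≤ {z} {x} {y} 0≤z x≤y = begin
    x * z  ≈⟨ *-comm x z ⟩
    z * x  ≤⟨ *-monoˡ-≤ 0≤z x≤y ⟩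
    z * y  ≈⟨ *-comm z y ⟩
    y * z  ∎
    where open ≤-Reasoning

  ≰⇒> : ∀ {x y} → ¬ x ≤ y → y < x
  ≰⇒> {x} {y} x≰y with ≤-total x y
  ... | inj₁ x≤y = contradiction x≤y x≰y
  ... | inj₂ y≤x = y≤x , λ y≈x → x≰y (≤-reflexive (≈-sym y≈x))

  ≰⇒≥ : ∀ {x y} → ¬ x ≤ y → y ≤ x
  ≰⇒≥ x≰y = proj₁ (≰⇒> x≰y)

  <⇒≱ : ∀ {x y} → x < y → ¬ y ≤ x
  <⇒≱ (x≤y , x≉y) y≤x = x≉y (≤-antisym x≤y y≤x)

  <-≤-trans : ∀ {x y z} → x < y → y ≤ z → x < z
  <-≤-trans x<y y≤z = ≰⇒> λ z≤x → <⇒≱ x<y (≤-trans y≤z z≤x)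

  ≤-<-trans : ∀ {x y z} → x ≤ y → y < z → x < z
  ≤-<-trans x≤y y<z = ≰⇒> λ z≤x → <⇒≱ y<z (≤-trans z≤x x≤y)

  <-transport : ∀ {p q x y} → p < q → y + p ≈ x + q → x < y
  <-transport {p} {q} {x} {y} p<q eq = ≰⇒> λ y≤x →
    <⇒≱ p<q (≤-transport y≤x (begin
      p + y  ≈⟨ +-comm p y ⟩
      y + p  ≈⟨ eq ⟩
      x + q  ≈⟨ +-comm x q ⟩
      q + x  ∎))
    where open SetoidReasoning setoid

  0≤1 : 0# ≤ 1#
  0≤1 with ≤-total 0# 1#
  ... | inj₁ p = p
  ... | inj₂ 1≤0 = ≤-respʳ-≈
    (solve 0 ((con (+ 0) :- con (+ 1)) :* (con (+ 0) :- con (+ 1)) := con (+ 1)) ≈-refl)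
    (*-nonNegative (x≤y⇒0≤y-x 1≤0) (x≤y⇒0≤y-x 1≤0))

  x≤1+x : ∀ x → x ≤ 1# + x
  x≤1+x x = ≤-respˡ-≈ (+-identityˡ x) (+-monoˡ-≤ x 0≤1)

  fromℕ-mono-≤ : ∀ {m n} → m ℕ.≤ n → fromℕ m ≤ fromℕ n
  fromℕ-mono-≤ {n = zero}  z≤n       = ≤-refl
  fromℕ-mono-≤ {n = suc n} z≤n       = ≤-trans (fromℕ-mono-≤ (z≤n {n})) (x≤1+x (fromℕ n))
  fromℕ-mono-≤             (s≤s m≤n) = +-mono-≤ ≤-refl (fromℕ-mono-≤ m≤n)

  0≤fromℕ : ∀ n → 0# ≤ fromℕ n
  0≤fromℕ n = fromℕ-mono-≤ (z≤n {n})

  1≤fromℕ : ∀ {n} → 1 ℕ.≤ n → 1# ≤ fromℕ n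
  1≤fromℕ 1≤n = ≤-respˡ-≈ (+-identityʳ 1#) (fromℕ-mono-≤ 1≤n)

  0<1 : 0# < 1#
  0<1 = 0≤1 , 0≉1

  0<⇒≉0 : ∀ {x} → 0# < x → ¬ x ≈ 0#
  0<⇒≉0 (_ , 0≉x) x≈0 = 0≉x (≈-sym x≈0)

  ⁻¹-nonNegative : ∀ {x} → 0# < x → 0# ≤ x ⁻¹
  ⁻¹-nonNegative {x} 0<x@(0≤x , _) with ≤-total 0# (x ⁻¹)
  ... | inj₁ p = p
  ... | inj₂ x⁻¹≤0 = contradiction (begin
    1#        ≈⟨ ⁻¹-inverseʳ (0<⇒≉0 0<x) ⟨
    x * x ⁻¹  ≤⟨ *-monoˡ-≤ 0≤x x⁻¹≤0 ⟩
    x * 0#    ≈⟨ zeroʳ x ⟩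
    0#        ∎) (<⇒≱ 0<1)
    where open ≤-Reasoning

  2# ½ : Carrier
  2# = 1# + 1#
  ½ = 2# ⁻¹

  0<2 : 0# < 2#
  0<2 = <-≤-trans 0<1 (x≤1+x 1#)

  half+half : ∀ x → x * ½ + x * ½ ≈ x
  half+half x = begin
    x * ½ + x * ½   ≈⟨ solve 2 (λ x h → x :* h :+ x :* h := x :* ((con (+ 1) :+ con (+ 1)) :* h)) ≈-refl x ½ ⟩
    x * (2# * ½)    ≈⟨ *-congˡ (⁻¹-inverseʳ (0<⇒≉0 0<2)) ⟩
    x * 1#          ≈⟨ *-identityʳ x ⟩
    x               ∎
    where open SetoidReasoning setoid

  half-pos : ∀ {x} → 0# < x → 0# < x * ½
  half-pos {x} 0<x = ≰⇒> λ h≤0 → <⇒≱ 0<x (begin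
    x              ≈⟨ half+half x ⟨
    x * ½ + x * ½  ≤⟨ +-mono-≤ h≤0 h≤0 ⟩
    0# + 0#        ≈⟨ +-identityˡ 0# ⟩
    0#             ∎)
    where open ≤-Reasoning

  -- Four copies of `ε` are what `length≤cover-total` loses: one at each end of the shrunken
  -- interval and two to the padding of the cover.
  ≤-from-slack : ∀ {x y} → (∀ {ε} → 0# < ε → x ≤ y + ((ε + ε) + (ε + ε))) → x ≤ y
  ≤-from-slack {x} {y} slack with x ≤? y
  ... | yes x≤y = x≤y
  ... | no  x≰y = contradiction (≤-transport x≤y+δ eq) (<⇒≱ (half-pos 0<x-y))
    where
    open ≤-Reasoning
    0<x-y : 0# < x - y
    0<x-y = <-transport (≰⇒> x≰y) (solve 2 (λ x y → (x :- y) :+ y := con (+ 0) :+ x) ≈-refl x y)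
    -- Half the gap, so `y + δ` still lies below `x`; `ε` is a quarter of `δ`, so four copies
    -- restore it exactly.
    δ = (x - y) * ½
    ε = δ * ½ * ½
    x≤y+δ : x ≤ y + δ
    x≤y+δ = begin
      x                        ≤⟨ slack (half-pos (half-pos (half-pos 0<x-y))) ⟩
      y + ((ε + ε) + (ε + ε))  ≈⟨ +-congˡ (+-cong (half+half _) (half+half _)) ⟩
      y + (δ * ½ + δ * ½)      ≈⟨ +-congˡ (half+half δ) ⟩
      y + δ                    ∎
    eq : 0# + x ≈ δ + (y + δ)
    eq = begin-equality
      0# + x         ≈⟨ solve 2 (λ x y → con (+ 0) :+ x := y :+ (x :- y)) ≈-refl x y ⟩
      y + (x - y)    ≈⟨ +-congˡ (half+half _) ⟨
      y + (δ + δ)    ≈⟨ solve 2 (λ y δ → y :+ (δ :+ δ) := δ :+ (y :+ δ)) ≈-refl y δ ⟩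
      δ + (y + δ)    ∎

-- Lebesgue measure of open intervals

module IntervalMeasure (ℝ : CompleteOrderedField) where
  open OrderedField ℝ
  open Lebesgue ℝ
  private
    module ≤-Reasoning = PartialOrderReasoning poset

  OpenInterval : Carrier → Carrier → Pred Carrier 0ℓ
  OpenInterval a b x = a < x × x < b

  cover-total≥0 : ∀ {A t} → Cover A t → 0# ≤ t
  cover-total≥0 C = proj₁ (Cover.total-isSum C) (0 , ≈-refl)

  -- The clipped lengths of the padded cover intervals bound x - a as long as
  -- finitely many of them suffice; a supremum argument carries this to b,
  -- in place of compactness.
  module PaddedCover {A total} (cover : Cover A total) (ε : Carrier) (0<ε : 0# < ε) where

    open Cover cover

    -- A geometric padding: `pad k` is ε/2^(k+1), and `tail k` is ε/2^k, the sum of all pads from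
    -- index `k` on. The whole padding thus costs at most `ε` on each side.
    tail pad lo hi : ℕ → Carrier
    tail zero    = ε
    tail (suc k) = tail k * ½
    pad k = tail (suc k)
    lo k = left k - pad k
    hi k = right k + pad k

    tail>0 : ∀ k → 0# < tail k
    tail>0 zero    = 0<ε
    tail>0 (suc k) = half-pos (tail>0 k)

    lo<left : ∀ k → lo k < left k
    lo<left k = <-transport (tail>0 (suc k))
      (solve 2 (λ l p → l :+ con (+ 0) := (l :- p) :+ p) ≈-refl (left k) (pad k))

    right<hi : ∀ k → right k < hi k
    right<hi k = <-transport (tail>0 (suc k))
      (solve 2 (λ r p → (r :+ p) :+ con (+ 0) := r :+ p) ≈-refl (right k) (pad k))

    lo≤hi : ∀ k → lo k ≤ hi k
    lo≤hi k = ≤-trans (proj₁ (lo<left k)) (≤-trans (left≤right k) (proj₁ (right<hi k)))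

    -- The nearest point projection to the padded interval. Hence `clip k x - lo k` is the length of
    -- the part of that interval below `x`.
    clip : ℕ → Carrier → Carrier
    clip k x = lo k ⊔ (x ⊓ hi k)

    clipped : Carrier → ℕ → Carrier
    clipped x = partialSum (λ j → clip j x - lo j)

    lo≤clip : ∀ k x → lo k ≤ clip k x
    lo≤clip k x = x≤x⊔y (lo k) (x ⊓ hi k)

    clip≤hi : ∀ k x → clip k x ≤ hi k
    clip≤hi k x = ⊔-lub (lo≤hi k) (x⊓y≤y x (hi k))

    clip-mono : ∀ k {x y} → x ≤ y → clip k x ≤ clip k y
    clip-mono k x≤y = ⊔-monoʳ-≤ (lo k) (⊓-monoˡ-≤ (hi k) x≤y)

    clip-inside : ∀ k {x} → lo k ≤ x → x ≤ hi k → clip k x ≈ x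
    clip-inside k {x} lo≤x x≤hi = ≈-trans (x≤y⇒x⊔y≈y (≤-respʳ-≈ (≈-sym eq) lo≤x)) eq
      where
      eq : x ⊓ hi k ≈ x
      eq = x≤y⇒x⊓y≈x x≤hi

    clipped-mono : ∀ {x y} → x ≤ y → ∀ k → clipped x k ≤ clipped y k
    clipped-mono x≤y zero    = ≤-refl
    clipped-mono x≤y (suc k) =
      +-mono-≤ (clipped-mono x≤y k) (+-monoˡ-≤ (- lo k) (clip-mono k x≤y))

    clipped-mono-index : ∀ {x k m} → k ℕ.≤′ m → clipped x k ≤ clipped x m
    clipped-mono-index ℕ.≤′-refl = ≤-refl
    clipped-mono-index {x} (ℕ.≤′-step {m} k≤m) = ≤-trans (clipped-mono-index k≤m)
      (≤-transport (lo≤clip m x)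
        (solve 3 (λ s c l → (s :+ (c :- l)) :+ l := s :+ c) ≈-refl (clipped x m) (clip m x) (lo m)))

    -- Both points lie in padded interval `j`, so its term gains the full `y - x`; every other term
    -- is monotone.
    clipped-grows : ∀ {x y j m} → suc j ℕ.≤′ m → lo j ≤ x → x ≤ y → y ≤ hi j →
                    (y - x) + clipped x m ≤ clipped y m
    clipped-grows {x} {y} {j} ℕ.≤′-refl lo≤x x≤y y≤hi = begin
      (y - x) + (clipped x j + (clip j x - lo j))
        ≈⟨ +-congˡ (+-congˡ (+-congʳ (clip-inside j lo≤x (≤-trans x≤y y≤hi)))) ⟩
      (y - x) + (clipped x j + (x - lo j))
        ≈⟨ solve 4 (λ x y s l → (y :- x) :+ (s :+ (x :- l)) := s :+ (y :- l)) ≈-refl x y (clipped x j) (lo j) ⟩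
      clipped x j + (y - lo j)
        ≤⟨ +-monoˡ-≤ _ (clipped-mono x≤y j) ⟩
      clipped y j + (y - lo j)
        ≈⟨ +-congˡ (+-congʳ (clip-inside j (≤-trans lo≤x x≤y) y≤hi)) ⟨
      clipped y j + (clip j y - lo j) ∎
      where open ≤-Reasoning
    clipped-grows {x} {y} (ℕ.≤′-step {m} j<m) lo≤x x≤y y≤hi =
      ≤-respˡ-≈ (+-assoc _ _ _)
        (+-mono-≤ (clipped-grows j<m lo≤x x≤y y≤hi) (+-monoˡ-≤ (- lo m) (clip-mono m x≤y)))

    -- The unspent padding `tail k + tail k` on the left makes the induction close: interval `k`
    -- uses two pads, and two pads are exactly what the two tails lose in passing to `suc k`.
    clipped≤lengths : ∀ x k →
      clipped x k + (tail k + tail k) ≤ partialSum (λ j → right j - left j) k + (ε + ε)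
    clipped≤lengths x zero    = ≤-refl
    clipped≤lengths x (suc k) = begin
      (clipped x k + (clip k x - lo k)) + (p + p)
        ≤⟨ +-monoˡ-≤ _ (+-mono-≤ ≤-refl (+-monoˡ-≤ (- lo k) (clip≤hi k x))) ⟩
      (clipped x k + ((right k + p) - (left k - p))) + (p + p)
        ≈⟨ solve 4 (λ s r l p → (s :+ ((r :+ p) :- (l :- p))) :+ (p :+ p) :=
                      (s :+ ((p :+ p) :+ (p :+ p))) :+ (r :- l)) ≈-refl (clipped x k) (right k) (left k) p ⟩
      (clipped x k + ((p + p) + (p + p))) + (right k - left k)
        ≈⟨ +-congʳ (+-congˡ (+-cong (half+half (tail k)) (half+half (tail k)))) ⟩
      (clipped x k + (tail k + tail k)) + (right k - left k)
        ≤⟨ +-monoˡ-≤ _ (clipped≤lengths x k) ⟩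
      (partialSum _ k + (ε + ε)) + (right k - left k)
        ≈⟨ solve 3 (λ s e d → (s :+ e) :+ d := (s :+ d) :+ e) ≈-refl (partialSum _ k) (ε + ε) (right k - left k) ⟩
      (partialSum _ k + (right k - left k)) + (ε + ε) ∎
      where
      open ≤-Reasoning
      p = pad k

    clipped≤total : ∀ x k → clipped x k ≤ total + (ε + ε)
    clipped≤total x k = begin
      clipped x k                         ≈⟨ +-identityʳ _ ⟨
      clipped x k + 0#                    ≈⟨ +-congˡ (+-identityʳ _) ⟨
      clipped x k + (0# + 0#)             ≤⟨ +-mono-≤ ≤-refl (+-mono-≤ (proj₁ (tail>0 k)) (proj₁ (tail>0 k))) ⟩
      clipped x k + (tail k + tail k)     ≤⟨ clipped≤lengths x k ⟩
      partialSum _ k + (ε + ε)            ≤⟨ +-monoˡ-≤ _ (proj₁ total-isSum (k , ≈-refl)) ⟩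
      total + (ε + ε)                     ∎
      where open ≤-Reasoning

    -- A point `x` is reached when finitely many padded intervals account for the length `x - a`.
    -- The supremum `s` of the reached points lies in some cover interval `j`, hence strictly inside
    -- its padding. From a reached point above `lo j`, that interval reaches either `b`, which gives
    -- the bound, or `hi j`, which is beyond `s`.
    closed-length≤total : ∀ {a b} → a ≤ b → (∀ {x} → x ∈[ a , b ] → A x) →
                          b ≤ a + (total + (ε + ε))
    closed-length≤total {a} {b} a≤b [a,b]⊆A = decidable-stable (b ≤? _) λ b≰goal →
      -- `lo j < s` only says that `lo j` is no upper bound; it does not exhibit a reached point
      -- above it. Arguing by contradiction, each such point would prove the goal, so `lo j` becomes
      -- an upper bound after all.
      let escape : ∀ {x} → Reached x → x ≤ lo j
          escape {x} Rx = decidable-stable (x ≤? lo j) λ x≰lo →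
            b≰goal (finish Rx (proj₁ (≰⇒> x≰lo)))
      in <⇒≱ lo<s (proj₂ isSup escape)
      where
      Reached : Pred Carrier 0ℓ
      Reached x = x ∈[ a , b ] × ∃[ k ] x ≤ a + clipped x k

      reached-a : Reached a
      reached-a = (≤-refl , a≤b) , 0 , ≤-reflexive (≈-sym (+-identityʳ a))

      sup : ∃[ s ] IsSupremum Reached s
      sup = supremum Reached (a , reached-a) (b , λ Rx → proj₂ (proj₁ Rx))

      s = proj₁ sup
      isSup = proj₂ sup

      s-covered : ∃[ k ] s ∈[ left k , right k ]
      s-covered = covers ([a,b]⊆A (proj₁ isSup reached-a , proj₂ isSup λ Rx → proj₂ (proj₁ Rx)))

      j = proj₁ s-covered

      lo<s : lo j < s
      lo<s = <-≤-trans (lo<left j) (proj₁ (proj₂ s-covered))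

      s<hi : s < hi j
      s<hi = ≤-<-trans (proj₂ (proj₂ s-covered)) (right<hi j)

      extend : ∀ {x y} → Reached x → lo j ≤ x → x ≤ y → y ≤ hi j → ∃[ k ] y ≤ a + clipped y k
      extend {x} {y} (_ , k , x≤) lo≤x x≤y y≤hi = m , (begin
        y                                ≈⟨ solve 2 (λ x y → y := x :+ (y :- x)) ≈-refl x y ⟩
        x + (y - x)                      ≤⟨ +-monoˡ-≤ _ x≤ ⟩
        (a + clipped x k) + (y - x)      ≤⟨ +-monoˡ-≤ _ (+-mono-≤ ≤-refl (clipped-mono-index (ℕ.≤⇒≤′ (ℕ.m≤m⊔n k (suc j))))) ⟩
        (a + clipped x m) + (y - x)      ≈⟨ solve 3 (λ a s d → (a :+ s) :+ d := a :+ (d :+ s)) ≈-refl a (clipped x m) (y - x) ⟩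
        a + ((y - x) + clipped x m)      ≤⟨ +-mono-≤ ≤-refl (clipped-grows (ℕ.≤⇒≤′ (ℕ.m≤n⊔m k (suc j))) lo≤x x≤y y≤hi) ⟩
        a + clipped y m                  ∎)
        where
        open ≤-Reasoning
        -- Enough terms to include the first `k` intervals as well as interval `j`.
        m = k ℕ.⊔ suc j

      finish : ∀ {x} → Reached x → lo j ≤ x → b ≤ a + (total + (ε + ε))
      finish Rx@((a≤x , x≤b) , _) lo≤x with b ≤? hi j
      ... | yes b≤hi =
        let k , b≤ = extend Rx lo≤x x≤b b≤hi
        in ≤-trans b≤ (+-mono-≤ ≤-refl (clipped≤total b k))
      ... | no b≰hi =
        let x≤hi = ≤-trans (proj₁ isSup Rx) (proj₁ s<hi)
        in contradiction
             (proj₁ isSup ((≤-trans a≤x x≤hi , ≰⇒≥ b≰hi) , extend Rx lo≤x x≤hi ≤-refl))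
             (<⇒≱ s<hi)

  -- The supremum argument needs its endpoints covered, so it is run on the closed interval from
  -- `a + ε` to `b - ε`. If these ends are out of order, `b - a` is at most `ε + ε` and the slack
  -- alone suffices.
  length≤cover-total : ∀ {a b t} → Cover (OpenInterval a b) t → b - a ≤ t
  length≤cover-total {a} {b} {t} C = ≤-from-slack bound
    where
    bound : ∀ {ε} → 0# < ε → b - a ≤ t + ((ε + ε) + (ε + ε))
    bound {ε} 0<ε with a + ε ≤? b - ε
    ... | yes a′≤b′ = ≤-transport
      (PaddedCover.closed-length≤total C ε 0<ε a′≤b′ λ (a′≤x , x≤b′) →
        <-≤-trans (<-transport 0<ε (solve 2 (λ a e → (a :+ e) :+ con (+ 0) := a :+ e) ≈-refl a ε)) a′≤x ,
        ≤-<-trans x≤b′ (<-transport 0<ε (solve 2 (λ b e → b :+ con (+ 0) := (b :- e) :+ e) ≈-refl b ε)))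
      (solve 4 (λ a b t e → (t :+ ((e :+ e) :+ (e :+ e))) :+ (b :- e) :=
                            (b :- a) :+ ((a :+ e) :+ (t :+ (e :+ e)))) ≈-refl a b t ε)
    ... | no a′≰b′ = ≤-transport
      (+-mono-≤ (≰⇒≥ a′≰b′) (+-mono-≤ (cover-total≥0 C) (+-mono-≤ (proj₁ 0<ε) (proj₁ 0<ε))))
      (solve 4 (λ a b t e →
          (t :+ ((e :+ e) :+ (e :+ e))) :+ ((b :- e) :+ (con (+ 0) :+ (con (+ 0) :+ con (+ 0)))) :=
          (b :- a) :+ ((a :+ e) :+ (t :+ (e :+ e)))) ≈-refl a b t ε)

  private
    -- A cover is an infinite sequence; all entries after the first are the degenerate interval from
    -- `0#` to `0#`, of length zero.
    single : Carrier → ℕ → Carrier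
    single x zero    = x
    single x (suc _) = 0#

    partialSum-single : ∀ a b k → partialSum (λ i → single b i - single a i) (suc k) ≈ b - a
    partialSum-single a b zero    = +-identityˡ _
    partialSum-single a b (suc k) = ≈-trans (+-cong (partialSum-single a b k) (-‿inverseʳ 0#)) (+-identityʳ _)

  singleCover : ∀ {A a b} → a ≤ b → (∀ {x} → A x → x ∈[ a , b ]) → Cover A (b - a)
  singleCover {A} {a} {b} a≤b A⊆[a,b] = record
    { left = single a
    ; right = single b
    ; left≤right = λ { zero → a≤b ; (suc _) → ≤-refl }
    ; covers = λ Ax → 0 , A⊆[a,b] Ax
    ; total-isSum = upper , λ bounded → bounded (1 , ≈-sym (partialSum-single a b 0))
    }
    where
    upper : ∀ {s} → ∃[ k ] s ≈ partialSum (λ i → single b i - single a i) k → s ≤ b - a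
    upper (zero  , s≈) = ≤-trans (≤-reflexive s≈) (x≤y⇒0≤y-x a≤b)
    upper (suc k , s≈) = ≤-reflexive (≈-trans s≈ (partialSum-single a b k))

  openInterval-measure : ∀ {a b} → a ≤ b → IsOuterMeasure (OpenInterval a b) (b - a)
  openInterval-measure a≤b =
    length≤cover-total ,
    λ below → below (singleCover a≤b λ ((a≤x , _) , (x≤b , _)) → a≤x , x≤b)

  empty-measure : ∀ {A : Pred Carrier 0ℓ} → (∀ {x} → ¬ A x) → IsOuterMeasure A 0#
  empty-measure empty =
    cover-total≥0 ,
    λ below → ≤-respʳ-≈ (-‿inverseʳ 0#)
      (below (singleCover ≤-refl λ Ax → contradiction Ax empty))

  open⇒measurable : ∀ {A : Pred Carrier 0ℓ} →
    (∀ {x y} → x ≈ y → A x → A y) → IsOpen A → IsMeasurable A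
  open⇒measurable resp open-A = record
    { respects = resp
    ; openApproximation = λ 0<ε →
        _ , open-A , (λ Ax → Ax) , 0# , empty-measure (λ (Ax , ¬Ax) → ¬Ax Ax) , proj₁ 0<ε
    }

  openInterval-open : ∀ a b → IsOpen (OpenInterval a b)
  openInterval-open a b {x} (a<x , x<b) with ≤-total (x - a) (b - x)
  ... | inj₁ l≤r = x - a ,
    <-transport a<x (solve 2 (λ a x → (x :- a) :+ a := con (+ 0) :+ x) ≈-refl a x) ,
    λ {y} l u →
      ≤-<-trans (≤-reflexive (solve 2 (λ a x → a := x :- (x :- a)) ≈-refl a x)) l ,
      <-≤-trans u (≤-transport l≤r (solve 3 (λ a b x → b :+ (x :- a) := (x :+ (x :- a)) :+ (b :- x)) ≈-refl a b x))
  ... | inj₂ r≤l = b - x ,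
    <-transport x<b (solve 2 (λ b x → (b :- x) :+ x := con (+ 0) :+ b) ≈-refl b x) ,
    λ {y} l u →
      ≤-<-trans (≤-transport r≤l (solve 3 (λ a b x → (x :- (b :- x)) :+ (b :- x) := a :+ (x :- a)) ≈-refl a b x)) l ,
      <-≤-trans u (≤-reflexive (solve 2 (λ b x → x :+ (b :- x) := b) ≈-refl b x))

  openInterval-measurable : ∀ a b → IsMeasurable (OpenInterval a b)
  openInterval-measurable a b = open⇒measurable
    (λ x≈y (a<x , x<b) → <-≤-trans a<x (≤-reflexive x≈y) , ≤-<-trans (≤-reflexive (≈-sym x≈y)) x<b)
    (openInterval-open a b)

  intervalPiece : ∀ {f A B a b h} → A ≤ a → a ≤ b → b ≤ B → 0# ≤ h →
                  (∀ {x} → OpenInterval a b x → h ≤ f x) → Piece f A B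
  intervalPiece {a = a} {b} {h} A≤a a≤b b≤B 0≤h h≤f = record
    { set = OpenInterval a b
    ; height = h
    ; measure = b - a
    ; measurable = openInterval-measurable a b
    ; isMeasure = openInterval-measure a≤b
    ; inInterval = λ ((a≤x , _) , (x≤b , _)) → ≤-trans A≤a a≤x , ≤-trans x≤b b≤B
    ; height≥0 = 0≤h
    ; below = h≤f
    }

-- Finite sums and the layer cake formula

module Sums (ℝ : CompleteOrderedField) where
  open OrderedField ℝ
  private
    variable
      ℓ p : Level
      X Y : Set ℓ

  -- Replacing a filter by zero terms keeps the index list intact, so that double sums can be split
  -- and exchanged freely.
  when : ∀ {P : Set p} → Dec P → Carrier → Carrier
  when P? x = if does P? then x else 0#

  when-yes : ∀ {P : Set p} (P? : Dec P) {x} → P → when P? x ≈ x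
  when-yes (yes _) _ = ≈-refl
  when-yes (no ¬p) p = contradiction p ¬p

  when-no : ∀ {P : Set p} (P? : Dec P) {x} → ¬ P → when P? x ≈ 0#
  when-no (yes p) ¬p = contradiction p ¬p
  when-no (no _)  _  = ≈-refl

  ∑-cong : ∀ (xs : List X) {f g : X → Carrier} → (∀ {x} → x ∈ xs → f x ≈ g x) → ∑ xs f ≈ ∑ xs g
  ∑-cong []       f≈g = ≈-refl
  ∑-cong (x ∷ xs) f≈g = +-cong (f≈g (here ≡.refl)) (∑-cong xs λ x∈ → f≈g (there x∈))

  ∑-mono : ∀ (xs : List X) {f g : X → Carrier} → (∀ {x} → x ∈ xs → f x ≤ g x) → ∑ xs f ≤ ∑ xs g
  ∑-mono []       f≤g = ≤-refl
  ∑-mono (x ∷ xs) f≤g = +-mono-≤ (f≤g (here ≡.refl)) (∑-mono xs λ x∈ → f≤g (there x∈))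

  ∑-zero : ∀ (xs : List X) → ∑ xs (λ _ → 0#) ≈ 0#
  ∑-zero []       = ≈-refl
  ∑-zero (x ∷ xs) = ≈-trans (+-identityˡ _) (∑-zero xs)

  ∑-nonNegative : ∀ (xs : List X) {f : X → Carrier} → (∀ {x} → x ∈ xs → 0# ≤ f x) → 0# ≤ ∑ xs f
  ∑-nonNegative xs 0≤f = ≤-respˡ-≈ (∑-zero xs) (∑-mono xs 0≤f)

  term≤∑ : ∀ (xs : List X) {f : X → Carrier} → (∀ {x} → x ∈ xs → 0# ≤ f x) →
           ∀ {x} → x ∈ xs → f x ≤ ∑ xs f
  term≤∑ (x ∷ xs) 0≤f (here ≡.refl) = ≤-respˡ-≈ (+-identityʳ _)
    (+-mono-≤ ≤-refl (∑-nonNegative xs λ x∈ → 0≤f (there x∈)))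
  term≤∑ (y ∷ xs) 0≤f (there x∈) = ≤-respˡ-≈ (+-identityˡ _)
    (+-mono-≤ (0≤f (here ≡.refl)) (term≤∑ xs (λ x∈ → 0≤f (there x∈)) x∈))

  ∑-++ : ∀ (xs ys : List X) (f : X → Carrier) → ∑ (xs ++ ys) f ≈ ∑ xs f + ∑ ys f
  ∑-++ []       ys f = ≈-sym (+-identityˡ _)
  ∑-++ (x ∷ xs) ys f = ≈-trans (+-congˡ (∑-++ xs ys f)) (≈-sym (+-assoc _ _ _))

  ∑-map : ∀ (h : X → Y) (xs : List X) (f : Y → Carrier) → ∑ (map h xs) f ≡ ∑ xs (λ x → f (h x))
  ∑-map h []       f = ≡.refl
  ∑-map h (x ∷ xs) f = ≡.cong (λ s → f (h x) + s) (∑-map h xs f)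

  ∑-+ : ∀ (xs : List X) (f g : X → Carrier) → ∑ xs (λ x → f x + g x) ≈ ∑ xs f + ∑ xs g
  ∑-+ []       f g = ≈-sym (+-identityˡ _)
  ∑-+ (x ∷ xs) f g = ≈-trans (+-congˡ (∑-+ xs f g))
    (solve 4 (λ a b c d → (a :+ b) :+ (c :+ d) := (a :+ c) :+ (b :+ d)) ≈-refl (f x) (g x) (∑ xs f) (∑ xs g))

  ∑-*ˡ : ∀ (xs : List X) (f : X → Carrier) c → ∑ xs (λ x → c * f x) ≈ c * ∑ xs f
  ∑-*ˡ []       f c = ≈-sym (zeroʳ c)
  ∑-*ˡ (x ∷ xs) f c = ≈-trans (+-congˡ (∑-*ˡ xs f c)) (≈-sym (distribˡ c (f x) _))

  ∑-↭ : ∀ {xs ys : List X} (f : X → Carrier) → xs ↭ ys → ∑ xs f ≈ ∑ ys f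
  ∑-↭ f refl             = ≈-refl
  ∑-↭ f (prep x p)       = +-congˡ (∑-↭ f p)
  ∑-↭ f (swap {xs} x y p) = ≈-trans
    (solve 3 (λ x y s → x :+ (y :+ s) := y :+ (x :+ s)) ≈-refl (f x) (f y) (∑ xs f))
    (+-congˡ (+-congˡ (∑-↭ f p)))
  ∑-↭ f (trans p q)      = ≈-trans (∑-↭ f p) (∑-↭ f q)

  ∑-swap : ∀ (xs : List X) (ys : List Y) (f : X → Y → Carrier) →
           ∑ xs (λ x → ∑ ys (f x)) ≈ ∑ ys (λ y → ∑ xs (λ x → f x y))
  ∑-swap []       ys f = ≈-sym (∑-zero ys)
  ∑-swap (x ∷ xs) ys f = ≈-trans (+-congˡ (∑-swap xs ys f))
    (≈-sym (∑-+ ys (f x) (λ y → ∑ xs (λ x → f x y))))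

  ∑-filter : ∀ {P : Pred X p} (P? : Decidable P) (xs : List X) (f : X → Carrier) →
             ∑ (filter P? xs) f ≈ ∑ xs (λ x → when (P? x) (f x))
  ∑-filter P? []       f = ≈-refl
  ∑-filter P? (x ∷ xs) f with does (P? x)
  ... | true  = +-congˡ (∑-filter P? xs f)
  ... | false = ≈-trans (∑-filter P? xs f) (≈-sym (+-identityˡ _))

  ∑-cartesianProduct : ∀ (xs : List X) (ys : List Y) (f : X × Y → Carrier) →
    ∑ (cartesianProduct xs ys) f ≈ ∑ xs (λ x → ∑ ys (λ y → f (x , y)))
  ∑-cartesianProduct []       ys f = ≈-refl
  ∑-cartesianProduct (x ∷ xs) ys f = begin
    ∑ (map (x ,_) ys ++ cartesianProduct xs ys) f
      ≈⟨ ∑-++ (map (x ,_) ys) _ f ⟩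
    ∑ (map (x ,_) ys) f + ∑ (cartesianProduct xs ys) f
      ≈⟨ +-cong (≈-reflexive (∑-map (x ,_) ys f)) (∑-cartesianProduct xs ys f) ⟩
    ∑ ys (λ y → f (x , y)) + ∑ xs (λ x → ∑ ys (λ y → f (x , y))) ∎
    where open SetoidReasoning setoid

module LayerCake (ℝ : CompleteOrderedField) where
  open OrderedField ℝ
  open Lebesgue ℝ
  open Sums ℝ
  open IntervalMeasure ℝ

  module _ {X : Set} (m r : X → Carrier) (m≥0 : ∀ x → 0# ≤ m x) where

    -- With the masses of clusters for `m` and `ρ` for `r`, this unfolds to the `μ` of the set where
    -- `ρ` exceeds `t`.
    upperMass : List X → Carrier → Carrier
    upperMass xs t = ∑ (filter (λ x → t <? r x) xs) m

    upperMass-tail : ∀ x xs t → upperMass xs t ≤ upperMass (x ∷ xs) t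
    upperMass-tail x xs t with does (t <? r x)
    ... | true  = ≤-respˡ-≈ (+-identityˡ _) (+-monoˡ-≤ (upperMass xs t) (m≥0 x))
    ... | false = ≤-refl

    upperMass-↭ : ∀ {xs ys} t → xs ↭ ys → upperMass xs t ≈ upperMass ys t
    upperMass-↭ t xs↭ys = ∑-↭ m (↭.filter-↭ _ xs↭ys)

    private
      -- The bound `c < t` on all pieces is the induction invariant that keeps the next piece, which
      -- ends at the new base level, disjoint from them.
      Layers : (f : Carrier → Carrier) (A B c : Carrier) → List X → Set₁
      Layers f A B c xs =
        Σ[ ps ∈ List (Piece f A B) ]
          AllPairs (λ P Q → Empty (set P ∩ set Q)) ps ×
          All (λ P → ∀ {t} → set P t → c < t) ps ×
          ∑ xs (λ x → m x * (r x - c)) ≈ ∑ ps (λ P → height P * measure P)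

    -- One layer per element in increasing order of r: between consecutive
    -- values of r the mass above is constant.
    layers : ∀ {f A B c} xs → AllPairs (λ x y → r x ≤ r y) xs →
             A ≤ c → All (λ x → c ≤ r x) xs → All (λ x → r x ≤ B) xs →
             (∀ {t} → c < t → t < B → upperMass xs t ≤ f t) → Layers f A B c xs
    layers [] [] A≤c [] [] below = [] , [] , [] , ≈-refl
    layers {f} {A} {B} {c} (x ∷ xs) (x≤xs ∷ sorted) A≤c (c≤x ∷ c≤xs) (x≤B ∷ xs≤B) below =
      let ps , disjoint , above , eq = layers xs sorted (≤-trans A≤c c≤x) x≤xs xs≤B
            λ {t} x<t t<B → ≤-trans (upperMass-tail x xs t) (below (≤-<-trans c≤x x<t) t<B)
      in P ∷ ps ,
         All.map (λ r<t _ ((_ , t<r) , t∈Q) → <⇒≱ t<r (proj₁ (r<t t∈Q))) above ∷ disjoint ,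
         proj₁ ∷ All.map (λ r<t {_} t∈Q → ≤-<-trans c≤x (r<t t∈Q)) above ,
         (begin
            m x * (r x - c) + ∑ xs (λ y → m y * (r y - c))
              -- Each later term is cut at level `r x`: the part below joins the new slab, whose
              -- height is the whole remaining mass, and the part above is the recursive sum.
              ≈⟨ +-congˡ (∑-cong xs λ {y} _ → solve 4 (λ m r s c → m :* (s :- c) := (r :- c) :* m :+ m :* (s :- r)) ≈-refl (m y) (r x) (r y) c) ⟩
            m x * (r x - c) + ∑ xs (λ y → (r x - c) * m y + m y * (r y - r x))
              ≈⟨ +-congˡ (∑-+ xs _ _) ⟩
            m x * (r x - c) + (∑ xs (λ y → (r x - c) * m y) + ∑ xs (λ y → m y * (r y - r x)))
              ≈⟨ +-congˡ (+-cong (∑-*ˡ xs m (r x - c)) eq) ⟩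
            m x * (r x - c) + ((r x - c) * ∑ xs m + ∑ ps (λ P → height P * measure P))
              ≈⟨ solve 4 (λ m d s p → m :* d :+ (d :* s :+ p) := (m :+ s) :* d :+ p) ≈-refl (m x) (r x - c) (∑ xs m) (∑ ps (λ P → height P * measure P)) ⟩
            (m x + ∑ xs m) * (r x - c) + ∑ ps (λ P → height P * measure P) ∎)
      where
      open SetoidReasoning setoid
      P : Piece f A B
      P = intervalPiece A≤c c≤x x≤B (∑-nonNegative (x ∷ xs) λ {y} _ → m≥0 y) λ {t} (c<t , t<x) →
        -- For `t` below `r x` the filter drops nothing, so the height of the piece is `upperMass`
        -- itself.
        ≤-trans (≤-reflexive (≈-reflexive (≡.cong (λ ys → ∑ ys m) (≡.sym
          (List.filter-all (λ y → t <? r y) (t<x ∷ All.map (<-≤-trans t<x) x≤xs))))))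
          (below c<t (<-≤-trans t<x x≤B))

    private
      byValue : DecTotalOrder 0ℓ 0ℓ 0ℓ
      byValue = On.decTotalOrder decTotalOrder r

    -- Both the weighted sum and `upperMass` are invariant under permutation, so the elements may be
    -- sorted by `r`. The layers then form a simple integral, one of the values whose supremum is
    -- `I`.
    layerCake-≤ : ∀ {f A B I} → IsIntegral f A B I → ∀ xs →
      (∀ {x} → x ∈ xs → r x ∈[ A , B ]) →
      (∀ {t} → t ∈[ A , B ] → upperMass xs t ≤ f t) →
      ∑ xs (λ x → m x * (r x - A)) ≤ I
    layerCake-≤ {A = A} {B} {I} integral xs range below = ≤-respˡ-≈ (∑-↭ _ ys↭xs)
      (proj₁ (IsIntegral.isSupremum integral)
        (let ps , disjoint , _ , eq = result in ps , disjoint , eq))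
      where
      open Sort byValue using (sort; sort-↭; sort-↗)
      ys↭xs = sort-↭ xs
      range′ : All (λ x → r x ∈[ A , B ]) (sort xs)
      range′ = All.tabulate λ x∈ → range (↭.∈-resp-↭ ys↭xs x∈)
      result = layers (sort xs) (Sorted⇒AllPairs (DecTotalOrder.totalOrder byValue) (sort-↗ xs)) ≤-refl
        (All.map proj₁ range′) (All.map proj₂ range′)
        λ {t} A<t t<B → ≤-respˡ-≈ (≈-sym (upperMass-↭ t ys↭xs)) (below (proj₁ A<t , proj₁ t<B))

-- Graphs and hierarchies

least-≤ : ∀ {P : Pred ℕ 0ℓ} (P? : Decidable P) bound {k} → P k → least P? bound ℕ.≤ k
least-≤ P? zero        Pk = z≤n
least-≤ P? (suc bound) {k} Pk with P? zero
... | yes _ = z≤n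
least-≤ P? (suc bound) {zero}  Pk | no ¬P0 = contradiction Pk ¬P0
least-≤ P? (suc bound) {suc k} Pk | no ¬P0 = s≤s (least-≤ (λ k → P? (suc k)) bound Pk)

least-satisfies : ∀ {P : Pred ℕ 0ℓ} (P? : Decidable P) bound → P bound → P (least P? bound)
least-satisfies P? zero        Pb = Pb
least-satisfies P? (suc bound) Pb with P? zero
... | yes P0 = P0
... | no  _  = least-satisfies (λ k → P? (suc k)) bound Pb

walk-++ : ∀ {V : Set} {R : Rel V 0ℓ} {j k x y z} → Walk R j x y → Walk R k y z → Walk R (j ℕ.+ k) x z
walk-++ []      q = q
walk-++ (r ∷ p) q = r ∷ walk-++ p q

Unique-++⁻ : ∀ {A : Set} (xs : List A) {ys} → Unique (xs ++ ys) →
             Unique xs × Unique ys × Disjoint xs ys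
Unique-++⁻ []       u = [] , u , λ { (() , _) }
Unique-++⁻ (x ∷ xs) (x≢ ∷ u) =
  let uxs , uys , disjoint = Unique-++⁻ xs u
  in All.++⁻ˡ xs x≢ ∷ uxs , uys ,
     λ { (here ≡.refl , v∈ys) → All.lookup (All.++⁻ʳ xs x≢) v∈ys ≡.refl
       ; (there v∈xs  , v∈ys) → disjoint (v∈xs , v∈ys) }

leaves-nonempty : ∀ {V} (t : Tree V) → ∃[ x ] x ∈ leaves t
leaves-nonempty (leaf x)   = x , here ≡.refl
leaves-nonempty (node l r) = let x , x∈l = leaves-nonempty l in x , ∈-++⁺ˡ x∈l

internal⇒subtree : ∀ {V} (t : Tree V) {l r} → (l , r) ∈ internals t → node l r ∈ subtrees t
internal⇒subtree (node l r) (here ≡.refl) = here ≡.refl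
internal⇒subtree (node l r) (there S∈) with ∈-++⁻ (internals l) S∈
... | inj₁ S∈l = there (∈-++⁺ˡ (internal⇒subtree l S∈l))
... | inj₂ S∈r = there (∈-++⁺ʳ (subtrees l) (internal⇒subtree r S∈r))

subtree-size : ∀ {V} (t : Tree V) {s} → s ∈ subtrees t → length (leaves s) ℕ.≤ length (leaves t)
subtree-size (leaf _)   (here ≡.refl) = ℕ.≤-refl
subtree-size (node l r) (here ≡.refl) = ℕ.≤-refl
subtree-size (node l r) (there s∈) rewrite List.length-++ (leaves l) {leaves r}
  with ∈-++⁻ (subtrees l) s∈
... | inj₁ s∈l = ℕ.≤-trans (subtree-size l s∈l) (ℕ.m≤m+n _ _)
... | inj₂ s∈r = ℕ.≤-trans (subtree-size r s∈r) (ℕ.m≤n+m _ _)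

module _ {n : ℕ} where

  open DecMembership (Fin._≟_ {n}) using (_∈?_)

  private
    both? : ∀ (x y : Fin n) (xs : List (Fin n)) → Dec (x ∈ xs × y ∈ xs)
    both? x y xs = x ∈? xs ×-dec y ∈? xs

  lca-left : ∀ l r {x y} → x ∈ leaves l → y ∈ leaves l → lca (node l r) x y ≡ lca l x y
  lca-left l r {x} {y} x∈ y∈ rewrite dec-true (both? x y (leaves l)) (x∈ , y∈) = ≡.refl

  lca-right : ∀ l r {x y} → Disjoint (leaves l) (leaves r) →
              x ∈ leaves r → y ∈ leaves r → lca (node l r) x y ≡ lca r x y
  lca-right l r {x} {y} disjoint x∈ y∈
    rewrite dec-false (both? x y (leaves l)) (λ (x∈l , _) → disjoint (x∈l , x∈))
          | dec-true (both? x y (leaves r)) (x∈ , y∈) = ≡.refl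

  lca-split : ∀ l r {x y} → Disjoint (leaves l) (leaves r) →
              x ∈ leaves l → y ∈ leaves r → lca (node l r) x y ≡ node l r
  lca-split l r {x} {y} disjoint x∈ y∈
    rewrite dec-false (both? x y (leaves l)) (λ (_ , y∈l) → disjoint (y∈l , y∈))
          | dec-false (both? x y (leaves r)) (λ (x∈r , _) → disjoint (x∈ , x∈r)) = ≡.refl

  lca-split′ : ∀ l r {x y} → Disjoint (leaves l) (leaves r) →
               x ∈ leaves r → y ∈ leaves l → lca (node l r) x y ≡ node l r
  lca-split′ l r {x} {y} disjoint x∈ y∈
    rewrite dec-false (both? x y (leaves l)) (λ (x∈l , _) → disjoint (x∈l , x∈))
          | dec-false (both? x y (leaves r)) (λ (_ , y∈r) → disjoint (y∈ , y∈r)) = ≡.refl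

  lca-contains : ∀ t {x y} → x ∈ leaves t → y ∈ leaves t →
                 lca t x y ∈ subtrees t × x ∈ lcaCluster t x y × y ∈ lcaCluster t x y
  lca-contains (leaf v) x∈ y∈ = here ≡.refl , x∈ , y∈
  lca-contains (node l r) {x} {y} x∈ y∈ with both? x y (leaves l)
  ... | yes p@(x∈l , y∈l) rewrite dec-true (both? x y (leaves l)) p =
    let s∈ , rest = lca-contains l x∈l y∈l in there (∈-++⁺ˡ s∈) , rest
  ... | no ¬p rewrite dec-false (both? x y (leaves l)) ¬p with both? x y (leaves r)
  ... | yes q@(x∈r , y∈r) rewrite dec-true (both? x y (leaves r)) q =
    let s∈ , rest = lca-contains r x∈r y∈r in there (∈-++⁺ʳ (subtrees l) s∈) , rest
  ... | no ¬q rewrite dec-false (both? x y (leaves r)) ¬q = here ≡.refl , x∈ , y∈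

-- Distances and diameters in connected clusters

module Hierarchies (ℝ : CompleteOrderedField) {n : ℕ}
                   (G : Graphs.ConnectedWeightedGraph ℝ n) where

  open OrderedField ℝ
  open Sums ℝ
  open Graphs ℝ hiding (module ConnectedWeightedGraph)
  open Graphs.ConnectedWeightedGraph G

  private
    module ≤-Reasoning = PartialOrderReasoning poset
    V : Set
    V = Fin n

  dist-≤ : ∀ {k x y} → Walk Adj k x y → dist G x y ℕ.≤ k
  dist-≤ {x = x} {y} p = least-≤ (λ k → walk? Adj? k x y) (proj₁ (connected x y)) p

  dist-walk : ∀ x y → Walk Adj (dist G x y) x y
  dist-walk x y = least-satisfies (λ k → walk? Adj? k x y) (proj₁ (connected x y)) (proj₂ (connected x y))

  dist>0 : ∀ {x y} → x ≢ y → 1 ℕ.≤ dist G x y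
  dist>0 {x} {y} x≢y with dist G x y | dist-walk x y
  ... | zero  | []    = contradiction ≡.refl x≢y
  ... | suc _ | _ ∷ _ = s≤s z≤n

  dist≤diam : ∀ {S x y} → x ∈ S → y ∈ S → dist G x y ℕ.≤ diam G S
  dist≤diam x∈ y∈ = All.lookup (Extrema.xs≤max 0 _) (∈-cartesianProductWith⁺ (dist G) x∈ y∈)

  diam-≤ : ∀ {S b} → (∀ {x y} → x ∈ S → y ∈ S → dist G x y ℕ.≤ b) → diam G S ℕ.≤ b
  diam-≤ {S} bound = Extrema.max≤v⁺ z≤n
    (All.cartesianProductWith⁺ (≡-setoid V) (≡-setoid V) (dist G) S S bound)

  -- Hereditary form of IsConnectedHierarchy, so that it passes to subtrees.
  record IsConnectedTree (t : Tree V) : Set where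
    constructor _,_
    field
      unique    : Unique (leaves t)
      connected : All (λ s → InducesConnected G (leaves s)) (subtrees t)

  isConnectedTree : ∀ {T} → IsConnectedHierarchy G T → IsConnectedTree T
  isConnectedTree {T} (T↭ , connected) =
    ↭ₛ.Unique-resp-↭ (≡-setoid V) (↭⇒↭ₛ (↭-sym T↭)) (Unique.allFin⁺ n) , connected

  module _ {l r : Tree V} where

    leftTree : IsConnectedTree (node l r) → IsConnectedTree l
    leftTree (unique , _ ∷ conn) = proj₁ (Unique-++⁻ (leaves l) unique) , All.++⁻ˡ (subtrees l) conn

    rightTree : IsConnectedTree (node l r) → IsConnectedTree r
    rightTree (unique , _ ∷ conn) =
      proj₁ (proj₂ (Unique-++⁻ (leaves l) unique)) , All.++⁻ʳ (subtrees l) conn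

    children-disjoint : IsConnectedTree (node l r) → Disjoint (leaves l) (leaves r)
    children-disjoint (unique , _) = proj₂ (proj₂ (Unique-++⁻ (leaves l) unique))

  -- Follow the walk until its first step out of `xs`, which must land in `ys`. Disjointness rules
  -- out the empty walk.
  crossing-edge : ∀ {xs ys S : List V} → Disjoint xs ys → (∀ {z} → z ∈ S → z ∈ xs ++ ys) →
    ∀ {k x y} → Walk (λ u v → u ∈ S × v ∈ S × Adj u v) k x y → x ∈ xs → y ∈ ys →
    ∃[ u ] ∃[ v ] (u ∈ xs × v ∈ ys × Adj u v)
  crossing-edge disjoint S⊆ [] x∈ y∈ = contradiction (x∈ , y∈) disjoint
  crossing-edge {xs} disjoint S⊆ ((_ , z∈S , x~z) ∷ p) x∈ y∈ with ∈-++⁻ xs (S⊆ z∈S)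
  ... | inj₁ z∈xs = crossing-edge disjoint S⊆ p z∈xs y∈
  ... | inj₂ z∈ys = _ , _ , x∈ , z∈ys , x~z

  -- Connectedness of clusters takes effect through this edge: it joins the walks in the two
  -- children, makes the diameter positive and makes the cut weight positive.
  cut-edge : ∀ {l r} → IsConnectedTree (node l r) →
             ∃[ u ] ∃[ v ] (u ∈ leaves l × v ∈ leaves r × Adj u v)
  cut-edge {l} {r} t@(_ , conn ∷ _) =
    let _ , x∈l = leaves-nonempty l
        _ , y∈r = leaves-nonempty r
        _ , p = conn (∈-++⁺ˡ x∈l) (∈-++⁺ʳ (leaves l) y∈r)
    in crossing-edge (children-disjoint t) (λ z∈ → z∈) p x∈l y∈r

  -- Inside a child by induction, across by a cut edge between two such walks.
  short-walk : ∀ t → IsConnectedTree t → ∀ {x y} → x ∈ leaves t → y ∈ leaves t →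
               ∃[ k ] (k ℕ.< length (leaves t) × Walk Adj k x y)
  short-walk (leaf v) _ (here ≡.refl) (here ≡.refl) = 0 , s≤s z≤n , []
  short-walk (node l r) t {x} {y} x∈ y∈ with ∈-++⁻ (leaves l) x∈ | ∈-++⁻ (leaves l) y∈
  ... | inj₁ x∈l | inj₁ y∈l =
    let k , k< , p = short-walk l (leftTree t) x∈l y∈l
    in k , ℕ.<-≤-trans k< (≡.subst (length (leaves l) ℕ.≤_) (≡.sym (List.length-++ (leaves l))) (ℕ.m≤m+n _ _)) , p
  ... | inj₂ x∈r | inj₂ y∈r =
    let k , k< , p = short-walk r (rightTree t) x∈r y∈r
    in k , ℕ.<-≤-trans k< (≡.subst (length (leaves r) ℕ.≤_) (≡.sym (List.length-++ (leaves l))) (ℕ.m≤n+m _ _)) , p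
  ... | inj₁ x∈l | inj₂ y∈r =
    let u , v , u∈l , v∈r , u~v = cut-edge t
        j , j< , p = short-walk l (leftTree t) x∈l u∈l
        k , k< , q = short-walk r (rightTree t) v∈r y∈r
    -- Both lengths are strictly below the sizes of the children, which leaves room for the cut
    -- edge.
    in j ℕ.+ suc k , ≡.subst (j ℕ.+ suc k ℕ.<_) (≡.sym (List.length-++ (leaves l))) (ℕ.+-mono-≤ j< k<) ,
       walk-++ p (u~v ∷ q)
  ... | inj₂ x∈r | inj₁ y∈l =
    let u , v , u∈l , v∈r , u~v = cut-edge t
        j , j< , p = short-walk r (rightTree t) x∈r v∈r
        k , k< , q = short-walk l (leftTree t) u∈l y∈l
    in j ℕ.+ suc k , ≡.subst (j ℕ.+ suc k ℕ.<_)
         (≡.trans (ℕ.+-comm (length (leaves r)) _) (≡.sym (List.length-++ (leaves l)))) (ℕ.+-mono-≤ j< k<) ,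
       walk-++ p (Adj-sym u~v ∷ q)

  dist<size : ∀ {t} → IsConnectedTree t → ∀ {x y} → x ∈ leaves t → y ∈ leaves t →
              dist G x y ℕ.≤ length (leaves t) ∸ 1
  dist<size {t} good x∈ y∈ =
    let k , k< , p = short-walk t good x∈ y∈
    in ℕ.≤-trans (dist-≤ p) (ℕ.∸-monoˡ-≤ 1 k<)

  subtree-connected : ∀ {t} → IsConnectedTree t → ∀ {s} → s ∈ subtrees t → IsConnectedTree s
  subtree-connected {leaf _}   good (here ≡.refl) = good
  subtree-connected {node l r} good (here ≡.refl) = good
  subtree-connected {node l r} good (there s∈) with ∈-++⁻ (subtrees l) s∈
  ... | inj₁ s∈l = subtree-connected (leftTree good) s∈l
  ... | inj₂ s∈r = subtree-connected (rightTree good) s∈r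

  hierarchy-size : ∀ {T : Tree V} → IsHierarchy T → length (leaves T) ≡ n
  hierarchy-size T↭ = ≡.trans (↭.↭-length T↭) (List.length-tabulate (λ (i : Fin n) → i))

  hierarchy-contains : ∀ {T : Tree V} → IsHierarchy T → ∀ x → x ∈ leaves T
  hierarchy-contains T↭ x = ↭.∈-resp-↭ (↭-sym T↭) (∈-allFin x)

  -- The ends of a cut edge lie in disjoint children, hence differ. This keeps the denominator of
  -- `ρ` away from zero.
  Δ≥1 : ∀ {l r} → IsConnectedTree (node l r) → 1 ℕ.≤ Δ G (l , r)
  Δ≥1 {l} {r} good =
    let u , v , u∈l , v∈r , _ = cut-edge good
    in ℕ.≤-trans (dist>0 λ u≡v → children-disjoint good (u∈l , ≡.subst (_∈ leaves r) (≡.sym u≡v) v∈r))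
         (dist≤diam (∈-++⁺ˡ u∈l) (∈-++⁺ʳ (leaves l) v∈r))

  Δ<size : ∀ {l r} → IsConnectedTree (node l r) → Δ G (l , r) ℕ.≤ length (cluster (l , r)) ∸ 1
  Δ<size good = diam-≤ (dist<size good)

  dist≤cardHeight : ∀ {T} → IsConnectedHierarchy G T → ∀ x y → dist G x y ℕ.≤ cardHeight T x y
  dist≤cardHeight {T} T-conn@(T↭ , _) x y with x Fin.≟ y
  ... | yes ≡.refl = dist-≤ []
  ... | no _ =
    let s∈ , x∈s , y∈s = lca-contains T (hierarchy-contains {T} T↭ x) (hierarchy-contains {T} T↭ y)
    in dist<size (subtree-connected (isConnectedTree T-conn) s∈) x∈s y∈s

  cutWeight-∑ : ∀ l r → cutWeight G (l , r) ≈
    ∑ (leaves l) (λ x → ∑ (leaves r) (λ y → when (Adj? x y) (weight x y)))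
  cutWeight-∑ l r = ≈-trans (∑-filter _ (cartesianProduct (leaves l) (leaves r)) _)
    (∑-cartesianProduct (leaves l) (leaves r) _)

  weight-term≥0 : ∀ {xs ys} {p : V × V} →
    p ∈ filter (λ (x , y) → Adj? x y) (cartesianProduct xs ys) → 0# ≤ uncurry weight p
  weight-term≥0 {xs} {ys} p∈ =
    proj₁ (weight-pos (proj₂ (∈-filter⁻ (λ (x , y) → Adj? x y) {xs = cartesianProduct xs ys} p∈)))

  cutWeight≥0 : ∀ S → 0# ≤ cutWeight G S
  cutWeight≥0 (l , r) = ∑-nonNegative _ (weight-term≥0 {leaves l} {leaves r})

  cutWeight>0 : ∀ {l r} → IsConnectedTree (node l r) → 0# < cutWeight G (l , r)
  cutWeight>0 {l} {r} good =
    let u , v , u∈l , v∈r , u~v = cut-edge good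
    in <-≤-trans (weight-pos u~v)
         (term≤∑ _ (weight-term≥0 {leaves l} {leaves r}) (∈-filter⁺ (λ (x , y) → Adj? x y) (∈-cartesianProduct⁺ u∈l v∈r) u~v))

  -- Edge costs as sums over internal clusters

  edgeTerm : (V → V → Carrier) → V → V → Carrier
  edgeTerm u x y = when (x Fin.<? y ×-dec Adj? x y) (weight x y * u x y)

  -- All ordered pairs are summed and the orientation test sits inside the term. The index order
  -- that selects one orientation of an edge is unrelated to the tree, so this form survives the
  -- change from `allFin n` to the order of the leaves.
  pairSum : (V → V → Carrier) → List V → List V → Carrier
  pairSum u xs ys = ∑ xs λ x → ∑ ys λ y → edgeTerm u x y

  cost-pairSum : ∀ u → cost G u ≈ pairSum u (allFin n) (allFin n)
  cost-pairSum u = ≈-trans (∑-filter _ (cartesianProduct (allFin n) (allFin n)) _)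
    (∑-cartesianProduct (allFin n) (allFin n) _)

  pairSum-↭ : ∀ u {xs ys} → xs ↭ ys → pairSum u xs xs ≈ pairSum u ys ys
  pairSum-↭ u {xs} p = ≈-trans (∑-cong xs λ _ → ∑-↭ _ p) (∑-↭ _ p)

  pairSum-cong : ∀ {u v} xs ys → (∀ {x y} → x ∈ xs → y ∈ ys → u x y ≡ v x y) →
                 pairSum u xs ys ≈ pairSum v xs ys
  pairSum-cong {u} {v} xs ys u≡v = ∑-cong xs λ {x} x∈ → ∑-cong ys λ {y} y∈ →
    ≈-reflexive (≡.cong (λ c → when (x Fin.<? y ×-dec Adj? x y) (weight x y * c)) (u≡v x∈ y∈))

  pairSum-++ : ∀ u xs ys → pairSum u (xs ++ ys) (xs ++ ys) ≈
    (pairSum u xs xs + pairSum u ys ys) + (pairSum u xs ys + pairSum u ys xs)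
  pairSum-++ u xs ys = begin
    pairSum u (xs ++ ys) (xs ++ ys)
      ≈⟨ ∑-++ xs ys _ ⟩
    pairSum u xs (xs ++ ys) + pairSum u ys (xs ++ ys)
      ≈⟨ +-cong (split xs) (split ys) ⟩
    (pairSum u xs xs + pairSum u xs ys) + (pairSum u ys xs + pairSum u ys ys)
      ≈⟨ solve 4 (λ a b c d → (a :+ b) :+ (c :+ d) := (a :+ d) :+ (b :+ c)) ≈-refl
           (pairSum u xs xs) (pairSum u xs ys) (pairSum u ys xs) (pairSum u ys ys) ⟩
    (pairSum u xs xs + pairSum u ys ys) + (pairSum u xs ys + pairSum u ys xs) ∎
    where
    open SetoidReasoning setoid
    split : ∀ zs → pairSum u zs (xs ++ ys) ≈ pairSum u zs xs + pairSum u zs ys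
    split zs = ≈-trans (∑-cong zs λ _ → ∑-++ xs ys _) (∑-+ zs _ _)

  -- Exactly one orientation of an edge is listed.
  edgeTerm-both : ∀ c x y →
    edgeTerm (λ _ _ → c) x y + edgeTerm (λ _ _ → c) y x ≈ c * when (Adj? x y) (weight x y)
  edgeTerm-both c x y with Adj? x y
  ... | no ¬x~y = begin
    when (x Fin.<? y ×-dec no ¬x~y) _ + edgeTerm (λ _ _ → c) y x
      ≈⟨ +-cong (when-no (x Fin.<? y ×-dec no ¬x~y) λ (_ , x~y) → ¬x~y x~y)
                (when-no (y Fin.<? x ×-dec Adj? y x) λ (_ , y~x) → ¬x~y (Adj-sym y~x)) ⟩
    0# + 0#  ≈⟨ +-identityˡ 0# ⟩
    0#       ≈⟨ zeroʳ c ⟨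
    c * 0#   ∎
    where open SetoidReasoning setoid
  ... | yes x~y with Fin.<-cmp x y
  ... | tri≈ _ x≡y _ = contradiction x~y (Adj-irrefl x≡y)
  ... | tri< x<y _ y≮x = begin
    when (x Fin.<? y ×-dec yes x~y) (weight x y * c) + edgeTerm (λ _ _ → c) y x
      ≈⟨ +-cong (when-yes (x Fin.<? y ×-dec yes x~y) (x<y , x~y))
                (when-no (y Fin.<? x ×-dec Adj? y x) λ (y<x , _) → y≮x y<x) ⟩
    weight x y * c + 0#   ≈⟨ +-identityʳ _ ⟩
    weight x y * c        ≈⟨ *-comm _ _ ⟩
    c * weight x y        ∎
    where open SetoidReasoning setoid
  ... | tri> x≮y _ y<x = begin
    when (x Fin.<? y ×-dec yes x~y) (weight x y * c) + edgeTerm (λ _ _ → c) y x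
      ≈⟨ +-cong (when-no (x Fin.<? y ×-dec yes x~y) λ (x<y , _) → x≮y x<y)
                (when-yes (y Fin.<? x ×-dec Adj? y x) (y<x , Adj-sym x~y)) ⟩
    0# + weight y x * c   ≈⟨ +-identityˡ _ ⟩
    weight y x * c        ≈⟨ *-comm _ _ ⟩
    c * weight y x        ≈⟨ *-congˡ (weight-sym x~y) ⟨
    c * weight x y        ∎
    where open SetoidReasoning setoid

  -- A cut edge contributes to just one of the two sums, according to which child holds the endpoint
  -- of smaller index. Exchanging the second double sum brings both orientations into one term.
  pairSum-cut : ∀ c l r →
    pairSum (λ _ _ → c) (leaves l) (leaves r) + pairSum (λ _ _ → c) (leaves r) (leaves l) ≈
    c * cutWeight G (l , r)
  pairSum-cut c l r = begin
    ∑ xs (λ x → ∑ ys λ y → e x y) + ∑ ys (λ y → ∑ xs λ x → e y x)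
      ≈⟨ +-congˡ (∑-swap ys xs e) ⟩
    ∑ xs (λ x → ∑ ys λ y → e x y) + ∑ xs (λ x → ∑ ys λ y → e y x)
      ≈⟨ ∑-+ xs _ _ ⟨
    ∑ xs (λ x → ∑ ys (λ y → e x y) + ∑ ys (λ y → e y x))
      ≈⟨ ∑-cong xs (λ {x} _ → ≈-trans (≈-sym (∑-+ ys _ _))
           (≈-trans (∑-cong ys λ {y} _ → edgeTerm-both c x y) (∑-*ˡ ys _ c))) ⟩
    ∑ xs (λ x → c * ∑ ys (λ y → when (Adj? x y) (weight x y)))
      ≈⟨ ∑-*ˡ xs _ c ⟩
    c * ∑ xs (λ x → ∑ ys (λ y → when (Adj? x y) (weight x y)))
      ≈⟨ *-congˡ (cutWeight-∑ l r) ⟨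
    c * cutWeight G (l , r) ∎
    where
    open SetoidReasoning setoid
    xs = leaves l
    ys = leaves r
    e = edgeTerm (λ _ _ → c)

  module _ (g : List V → Carrier) where

    -- Pairs inside a child keep their common ancestor there; pairs across meet at the root, where
    -- the value is constant and factors out of the cut. An arbitrary `g` serves both the diameter
    -- cost and the cardinality cost.
    pairSum-internals : ∀ {t} → IsConnectedTree t →
      pairSum (λ x y → g (lcaCluster t x y)) (leaves t) (leaves t) ≈
      ∑ (internals t) (λ S → g (cluster S) * cutWeight G S)
    pairSum-internals {leaf v} _ = ≈-trans (+-identityʳ _) (≈-trans (+-identityʳ _)
      (when-no (v Fin.<? v ×-dec Adj? v v) λ (_ , v~v) → Adj-irrefl ≡.refl v~v))
    pairSum-internals {node l r} good = begin
      pairSum u (xs ++ ys) (xs ++ ys)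
        ≈⟨ pairSum-++ u xs ys ⟩
      (pairSum u xs xs + pairSum u ys ys) + (pairSum u xs ys + pairSum u ys xs)
        ≈⟨ +-cong
             (+-cong (pairSum-cong xs xs λ x∈ y∈ → ≡.cong h (lca-left l r x∈ y∈))
                     (pairSum-cong ys ys λ x∈ y∈ → ≡.cong h (lca-right l r disjoint x∈ y∈)))
             (+-cong (pairSum-cong xs ys λ x∈ y∈ → ≡.cong h (lca-split l r disjoint x∈ y∈))
                     (pairSum-cong ys xs λ x∈ y∈ → ≡.cong h (lca-split′ l r disjoint x∈ y∈))) ⟩
      (pairSum (λ x y → h (lca l x y)) xs xs + pairSum (λ x y → h (lca r x y)) ys ys) +
      (pairSum (λ _ _ → c) xs ys + pairSum (λ _ _ → c) ys xs)
        ≈⟨ +-cong (+-cong (pairSum-internals (leftTree good)) (pairSum-internals (rightTree good)))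
                  (pairSum-cut c l r) ⟩
      (∑ (internals l) term + ∑ (internals r) term) + term (l , r)
        ≈⟨ +-congʳ (∑-++ (internals l) (internals r) term) ⟨
      ∑ (internals l ++ internals r) term + term (l , r)
        ≈⟨ +-comm _ _ ⟩
      ∑ (internals (node l r)) term ∎
      where
      open SetoidReasoning setoid
      xs = leaves l
      ys = leaves r
      h : Tree V → Carrier
      h t = g (leaves t)
      c = h (node l r)
      u : V → V → Carrier
      u x y = h (lca (node l r) x y)
      term : Internal V → Carrier
      term S = g (cluster S) * cutWeight G S
      disjoint = children-disjoint good

    cost-internals : ∀ {T} → IsConnectedHierarchy G T →
      cost G (λ x y → g (lcaCluster T x y)) ≈ ∑ (internals T) (λ S → g (cluster S) * cutWeight G S)
    cost-internals T-conn@(T↭ , _) = ≈-trans (cost-pairSum _)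
      (≈-trans (pairSum-↭ _ (↭-sym T↭)) (pairSum-internals (isConnectedTree T-conn)))

  F-internals : ∀ {T} → IsConnectedHierarchy G T → F G T ≈ ∑ (internals T) (a G)
  F-internals = cost-internals (λ S → fromℕ (diam G S))

  cost-cardHeight : ∀ {T} → IsConnectedHierarchy G T →
    cost G (λ x y → fromℕ (cardHeight T x y)) ≈
    ∑ (internals T) (λ S → fromℕ (length (cluster S) ∸ 1) * cutWeight G S)
  cost-cardHeight {T} T-conn = ≈-trans
    -- A listed edge has its smaller endpoint first, so its endpoints differ and the zero branch of
    -- `cardHeight` is avoided.
    (∑-cong (edges G) λ {(x , y)} xy∈ → *-congˡ (≈-reflexive (≡.cong fromℕ
      (≡.cong (if_then 0 else length (lcaCluster T x y) ∸ 1) (dec-false (x Fin.≟ y)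
        (Fin.<⇒≢ (proj₁ (proj₂ (∈-filter⁻ (λ (x , y) → x Fin.<? y ×-dec Adj? x y)
          {xs = cartesianProduct (allFin n) (allFin n)} xy∈)))))))))
    (cost-internals (λ S → fromℕ (length S ∸ 1)) T-conn)

  a≥0 : ∀ S → 0# ≤ a G S
  a≥0 S = *-nonNegative (0≤fromℕ (Δ G S)) (cutWeight≥0 S)

  -- The root alone suffices: it contributes a positive cut weight times a diameter of at least one.
  -- Two vertices ensure that the root is internal.
  F>0 : 2 ℕ.≤ n → ∀ {T} → IsConnectedHierarchy G T → 0# < F G T
  F>0 2≤n {T@(leaf _)} (T↭ , _) = contradiction (≡.subst (2 ℕ.≤_) (≡.sym (hierarchy-size {T} T↭)) 2≤n) λ { (s≤s ()) }
  F>0 2≤n {T@(node l r)} T-conn = <-≤-trans (cutWeight>0 good) (begin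
    cutWeight G (l , r)          ≈⟨ *-identityˡ _ ⟨
    1# * cutWeight G (l , r)     ≤⟨ *-monoʳ-≤ (cutWeight≥0 (l , r)) (1≤fromℕ (Δ≥1 good)) ⟩
    a G (l , r)                  ≤⟨ term≤∑ (internals T) (λ {S} _ → a≥0 S) (here ≡.refl) ⟩
    ∑ (internals T) (a G)        ≈⟨ F-internals T-conn ⟨
    F G T                        ∎)
    where
    open ≤-Reasoning
    good = isConnectedTree T-conn

-- The cardinality cost as a mean of `ρ`

module CardinalityCost (ℝ : CompleteOrderedField) {n : ℕ} (2≤n : 2 ℕ.≤ n)
    (G : Graphs.ConnectedWeightedGraph ℝ n)
    {T : Tree (Fin n)} (T-conn : Graphs.IsConnectedHierarchy ℝ G T) where

  open OrderedField ℝ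
  open Lebesgue ℝ
  open Graphs ℝ
  open Sums ℝ
  open LayerCake ℝ
  open Hierarchies ℝ G

  private
    module ≤-Reasoning = PartialOrderReasoning poset

  mass size d : Internal (Fin n) → Carrier
  mass S = a G S * F G T ⁻¹
  size S = fromℕ (length (cluster S) ∸ 1)
  d S = fromℕ (Δ G S)

  F*F⁻¹ : F G T * F G T ⁻¹ ≈ 1#
  F*F⁻¹ = ⁻¹-inverseʳ (0<⇒≉0 (F>0 2≤n T-conn))

  mass≥0 : ∀ S → 0# ≤ mass S
  mass≥0 S = *-nonNegative (a≥0 S) (⁻¹-nonNegative (F>0 2≤n T-conn))

  total-mass : ∑ (internals T) mass ≈ 1#
  total-mass = begin
    ∑ (internals T) mass                          ≈⟨ ∑-cong (internals T) (λ _ → *-comm _ _) ⟩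
    ∑ (internals T) (λ S → F G T ⁻¹ * a G S)      ≈⟨ ∑-*ˡ (internals T) (a G) (F G T ⁻¹) ⟩
    F G T ⁻¹ * ∑ (internals T) (a G)              ≈⟨ *-congˡ (F-internals T-conn) ⟨
    F G T ⁻¹ * F G T                              ≈⟨ *-comm _ _ ⟩
    F G T * F G T ⁻¹                              ≈⟨ F*F⁻¹ ⟩
    1#                                            ∎
    where open SetoidReasoning setoid

  module _ {S : Internal (Fin n)} (S∈ : S ∈ internals T) where

    private
      good : IsConnectedTree (node (proj₁ S) (proj₂ S))
      good = subtree-connected (isConnectedTree T-conn) (internal⇒subtree T S∈)

      1≤d : 1# ≤ d S
      1≤d = 1≤fromℕ (Δ≥1 good)

      0<d : 0# < d S
      0<d = <-≤-trans 0<1 1≤d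

      d*d⁻¹ : d S * d S ⁻¹ ≈ 1#
      d*d⁻¹ = ⁻¹-inverseʳ (0<⇒≉0 0<d)

      0≤d⁻¹ : 0# ≤ d S ⁻¹
      0≤d⁻¹ = ⁻¹-nonNegative 0<d

    -- Below, the diameter is at most the size minus one; above, the diameter is at least one and
    -- the size at most `n`. This is why the layers fit in the interval of integration.
    ρ-range : ρ G S ∈[ 1# , fromℕ (n ∸ 1) ]
    ρ-range = (begin
        1#               ≈⟨ d*d⁻¹ ⟨
        d S * d S ⁻¹     ≤⟨ *-monoʳ-≤ 0≤d⁻¹ (fromℕ-mono-≤ (Δ<size good)) ⟩
        size S * d S ⁻¹  ∎) , (begin
        size S * d S ⁻¹           ≤⟨ *-monoˡ-≤ (0≤fromℕ (length (cluster S) ∸ 1)) d⁻¹≤1 ⟩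
        size S * 1#               ≈⟨ *-identityʳ _ ⟩
        size S                    ≤⟨ fromℕ-mono-≤ (ℕ.∸-monoˡ-≤ 1 size≤n) ⟩
        fromℕ (n ∸ 1)             ∎)
      where
      open ≤-Reasoning
      d⁻¹≤1 : d S ⁻¹ ≤ 1#
      d⁻¹≤1 = begin
        d S ⁻¹        ≈⟨ *-identityˡ _ ⟨
        1# * d S ⁻¹   ≤⟨ *-monoʳ-≤ 0≤d⁻¹ 1≤d ⟩
        d S * d S ⁻¹  ≈⟨ d*d⁻¹ ⟩
        1#            ∎
      size≤n : length (cluster S) ℕ.≤ n
      size≤n = ≡.subst (length (cluster S) ℕ.≤_) (hierarchy-size {T} (proj₁ T-conn))
        (subtree-size T (internal⇒subtree T S∈))

    size-cut : size S * cutWeight G S ≈ F G T * (mass S * (ρ G S - 1#) + mass S)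
    size-cut = begin
      s * c
        -- The two unit factors become `F G T` and `d S` times their inverses, from which `mass S`
        -- and `ρ G S` are assembled.
        ≈⟨ solve 2 (λ s c → s :* c := s :* c :* (con (+ 1) :* con (+ 1))) ≈-refl s c ⟩
      s * c * (1# * 1#)
        ≈⟨ *-congˡ (*-cong F*F⁻¹ d*d⁻¹) ⟨
      s * c * ((f * f ⁻¹) * (d S * d S ⁻¹))
        ≈⟨ solve 6 (λ s c f f′ d d′ → s :* c :* ((f :* f′) :* (d :* d′)) :=
              f :* (((d :* c) :* f′) :* (s :* d′ :- con (+ 1)) :+ (d :* c) :* f′))
             ≈-refl s c f (f ⁻¹) (d S) (d S ⁻¹) ⟩
      f * (mass S * (ρ G S - 1#) + mass S) ∎
      where
      open SetoidReasoning setoid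
      s = size S
      c = cutWeight G S
      f = F G T

  cost-cardHeight-layers :
    cost G (λ x y → fromℕ (cardHeight T x y)) ≈
    F G T * (1# + ∑ (internals T) (λ S → mass S * (ρ G S - 1#)))
  cost-cardHeight-layers = begin
    cost G (λ x y → fromℕ (cardHeight T x y))
      ≈⟨ cost-cardHeight T-conn ⟩
    ∑ (internals T) (λ S → size S * cutWeight G S)
      ≈⟨ ∑-cong (internals T) size-cut ⟩
    ∑ (internals T) (λ S → F G T * (mass S * (ρ G S - 1#) + mass S))
      ≈⟨ ∑-*ˡ (internals T) _ (F G T) ⟩
    F G T * ∑ (internals T) (λ S → mass S * (ρ G S - 1#) + mass S)
      ≈⟨ *-congˡ (≈-trans (∑-+ (internals T) _ mass) (≈-trans (+-comm _ _) (+-congʳ total-mass))) ⟩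
    F G T * (1# + ∑ (internals T) (λ S → mass S * (ρ G S - 1#))) ∎
    where open SetoidReasoning setoid

  excess-≤ : ∀ {Φ I} → IsIntegral Φ 1# (fromℕ (n ∸ 1)) I →
    (∀ t → t ∈[ 1# , fromℕ (n ∸ 1) ] → μ G T (λ S → t <? ρ G S) ≤ Φ t) →
    ∑ (internals T) (λ S → mass S * (ρ G S - 1#)) ≤ I
  excess-≤ integral μ≤Φ =
    layerCake-≤ mass (ρ G) mass≥0 integral (internals T) ρ-range (λ {t} → μ≤Φ t)

  -- Together with `excess-≤` this makes the integral nonnegative, so the bound on `F G T` may be
  -- multiplied by one plus the integral.
  excess≥0 : 0# ≤ ∑ (internals T) (λ S → mass S * (ρ G S - 1#))
  excess≥0 = ∑-nonNegative (internals T) λ {S} S∈ →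
    *-nonNegative (mass≥0 S) (x≤y⇒0≤y-x (proj₁ (ρ-range S∈)))

theorem18 : (ℝ : CompleteOrderedField) →
    let open CompleteOrderedField ℝ
        open Lebesgue ℝ
        open Graphs ℝ
    in
    (n : ℕ) → 2 ℕ.≤ n →
    (G : ConnectedWeightedGraph n) →
    (optFree optCard : Carrier) → IsOPTfree G optFree → IsOPTcard G optCard →
    (T : Tree (Fin n)) → IsConnectedHierarchy G T →
    (α : Carrier) → 1# ≤ α →
    F G T ≤ α * optFree →
    (Φ : Carrier → Carrier) → IsNonNegativeOn Φ 1# (fromℕ (n ∸ 1)) →
    (∀ t → t ∈[ 1# , fromℕ (n ∸ 1) ] → μ G T (λ S → t <? ρ G S) ≤ Φ t) →
    (∫Φ : Carrier) → IsIntegral Φ 1# (fromℕ (n ∸ 1)) ∫Φ →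
    optCard ≤ α * (1# + ∫Φ) * optFree
theorem18 ℝ n 2≤n G optFree optCard _ isOPTcard T T-conn α _ F≤ Φ _ μ≤Φ ∫Φ integral = begin
  optCard
    ≤⟨ proj₂ isOPTcard (T , proj₁ T-conn , dist≤cardHeight T-conn , ≈-refl) ⟩
  cost G (λ x y → fromℕ (cardHeight T x y))
    ≈⟨ cost-cardHeight-layers ⟩
  F G T * (1# + excess)
    ≤⟨ *-monoˡ-≤ (proj₁ (F>0 2≤n T-conn)) (+-mono-≤ ≤-refl excess≤∫Φ) ⟩
  F G T * (1# + ∫Φ)
    ≤⟨ *-monoʳ-≤ (≤-trans (≤-trans excess≥0 excess≤∫Φ) (x≤1+x ∫Φ)) F≤ ⟩
  α * optFree * (1# + ∫Φ)
    ≈⟨ solve 3 (λ α o i → α :* o :* i := α :* i :* o) ≈-refl α optFree (1# + ∫Φ) ⟩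
  α * (1# + ∫Φ) * optFree ∎
  where
  open OrderedField ℝ
  open Graphs ℝ
  open Sums ℝ
  open Hierarchies ℝ G
  open CardinalityCost ℝ 2≤n G T-conn
  open PartialOrderReasoning poset
  excess = ∑ (internals T) (λ S → mass S * (ρ G S - 1#))
  excess≤∫Φ : excess ≤ ∫Φ
  excess≤∫Φ = excess-≤ integral μ≤Φ
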